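{- Let $q$ be a prime power and $n\geq \ell\geq 0$ integers. Let $\mathcal F\subseteq \mathbb F_q[x]$ be a family of monic polynomials of degree $n$ that is $\ell$-intersecting (every two members have a greatest common divisor of degree at least $\ell$) and has the maximum possible size $q^{n-\ell}$. Suppose $\mathcal F$ is primary, i.e. no non-unit polynomial divides every element of $\mathcal F$, and non-trivial, i.e. $\mathcal F$ is not the family of all monic degree-$n$ multiples of a fixed monic polynomial $g$ of degree $\ell$. Then either $\mathcal F$ is the exceptional family with $q=2$, $\ell=1$, $n=3$, \[ \mathcal F=\{x^2(x+1),~ x(x+1)^2,~ x(x^2+x+1),~ (x+1)(x^2+x+1)\}\subseteq \mathbb F_2[x], \] or, with $d=n-\ell>0$ and $H_d$ the monic least common multiple of all degree $d$ polynomials over $\mathbb F_q$, \[ \mathcal F=\mathcal F_d:=\left\{ \frac{H_d}{p}: p \text{ is a monic polynomial over } \mathbb F_q,\ \deg(p)=d\right\}. \]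
   Context: Families of monic polynomials in $\mathbb F_q[x]$ of fixed degree $n$; $\ell$-intersecting means pairwise gcd of degree at least $\ell$; the maximum size of such a family is $q^{n-\ell}$ (extremal families are those attaining it). The family $\mathcal F_d$ is a $(\deg(H_d)-2d)$-intersecting family of degree $\deg(H_d)-d$ monic polynomials of size $q^d$. -}

module Defs where

open import Level using (0ℓ)
open import Data.Nat as ℕ using (ℕ; zero; suc; _≤_; _<_; _^_; _∸_)
open import Data.Nat.Primality using (Prime)
open import Data.Fin using (Fin)
open import Data.List using (List; []; _∷_; length)
open import Data.List.Relation.Unary.All using (All)
open import Data.List.Relation.Unary.Any using (Any)
open import Data.List.Relation.Unary.AllPairs using (AllPairs)
open import Data.Product using (Σ; ∃; ∃-syntax; _×_; _,_)
open import Data.Sum using (_⊎_)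
open import Function.Bundles using (_↔_; _⇔_)
open import Relation.Binary.PropositionalEquality using (_≡_; _≢_)
open import Relation.Nullary using (¬_)
open import Algebra.Structures using (IsCommutativeRing)

IsPrimePower : ℕ → Set
IsPrimePower q = ∃[ p ] ∃[ k ] (Prime p × q ≡ p ^ suc k)

-- A finite field with exactly q elements (a model of F_q; all such are isomorphic).
record FiniteField (q : ℕ) : Set₁ where
  infixl 6 _+_
  infixl 7 _*_
  field
    Carrier : Set
    _+_ _*_ : Carrier → Carrier → Carrier
    -_      : Carrier → Carrier
    0# 1#   : Carrier
    isCommutativeRing : IsCommutativeRing _≡_ _+_ _*_ -_ 0# 1#
    0≢1     : 0# ≢ 1#
    inverse : ∀ x → x ≢ 0# → ∃[ y ] (x * y ≡ 1#)
    card    : Carrier ↔ Fin q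

module Poly {q : ℕ} (K : FiniteField q) where
  open FiniteField K

  -- Polynomials over K as coefficient lists, lowest degree first.
  -- Trailing zeros are allowed; equality is coefficientwise (_≈ₚ_).
  Pol : Set
  Pol = List Carrier

  coeff : Pol → ℕ → Carrier
  coeff []       _       = 0#
  coeff (a ∷ p)  zero    = a
  coeff (a ∷ p)  (suc i) = coeff p i

  _≈ₚ_ : Pol → Pol → Set
  p ≈ₚ r = ∀ i → coeff p i ≡ coeff r i

  addP : Pol → Pol → Pol
  addP []       r        = r
  addP p        []       = p
  addP (a ∷ p)  (b ∷ r)  = (a + b) ∷ addP p r

  scale : Carrier → Pol → Pol
  scale a []      = []
  scale a (b ∷ p) = (a * b) ∷ scale a p

  mulP : Pol → Pol → Pol
  mulP []      r = []
  mulP (a ∷ p) r = addP (scale a r) (0# ∷ mulP p r)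

  oneP : Pol
  oneP = 1# ∷ []

  HasDegree : Pol → ℕ → Set
  HasDegree p n = coeff p n ≢ 0# × (∀ i → n < i → coeff p i ≡ 0#)

  Monic : Pol → ℕ → Set
  Monic p n = coeff p n ≡ 1# × (∀ i → n < i → coeff p i ≡ 0#)

  _∣ₚ_ : Pol → Pol → Set
  g ∣ₚ f = ∃[ h ] (mulP g h ≈ₚ f)

  IsUnit : Pol → Set
  IsUnit g = ∃[ u ] (mulP g u ≈ₚ oneP)

  IsGCD : Pol → Pol → Pol → Set
  IsGCD d f g = d ∣ₚ f × d ∣ₚ g × (∀ e → e ∣ₚ f → e ∣ₚ g → e ∣ₚ d)

  GcdDegAtLeast : ℕ → Pol → Pol → Set
  GcdDegAtLeast ℓ f g = ∃[ d ] ∃[ m ] (IsGCD d f g × Monic d m × ℓ ≤ m)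

  -- Families are finite lists of pairwise distinct polynomials (distinct up to _≈ₚ_)
  _∈ₚ_ : Pol → List Pol → Set
  f ∈ₚ F = Any (f ≈ₚ_) F

  _equalsSet_ : List Pol → (Pol → Set) → Set
  F equalsSet S = ∀ f → (f ∈ₚ F) ⇔ S f

  IsFamily : ℕ → List Pol → Set
  IsFamily n F = All (λ f → Monic f n) F × AllPairs (λ a b → ¬ (a ≈ₚ b)) F

  LIntersecting : ℕ → List Pol → Set
  LIntersecting ℓ F = ∀ f g → f ∈ₚ F → g ∈ₚ F → GcdDegAtLeast ℓ f g

  Primary : List Pol → Set
  Primary F = ∀ g → (∀ f → f ∈ₚ F → g ∣ₚ f) → IsUnit g

  Trivial : ℕ → ℕ → List Pol → Set
  Trivial n ℓ F = ∃[ g ] (Monic g ℓ × F equalsSet (λ f → Monic f n × g ∣ₚ f))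

  IsLcmOfDeg : ℕ → Pol → Set
  IsLcmOfDeg d H =
    (∃[ m ] Monic H m) ×
    (∀ p → HasDegree p d → p ∣ₚ H) ×
    (∀ M → (∀ p → HasDegree p d → p ∣ₚ M) → H ∣ₚ M)

  InFd : ℕ → Pol → Pol → Set
  InFd d H f = ∃[ p ] (Monic p d × mulP p f ≈ₚ H)

  X X+1 : Pol
  X   = 0# ∷ 1# ∷ []
  X+1 = 1# ∷ 1# ∷ []

  X²+X+1 : Pol
  X²+X+1 = 1# ∷ 1# ∷ 1# ∷ []

  InExceptional : Pol → Set
  InExceptional f =
      f ≈ₚ mulP (mulP X X) X+1
    ⊎ f ≈ₚ mulP X (mulP X+1 X+1)
    ⊎ f ≈ₚ mulP X X²+X+1
    ⊎ f ≈ₚ mulP X+1 X²+X+1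

{-# OPTIONS --safe #-}

-- Put d = n − ℓ and let π be a monic irreducible polynomial of degree d. Members of F not divisible
-- by π are pairwise distinct and nonzero modulo π (the gcd of two of them is coprime to π, so the
-- product of both would divide their difference, of degree < n), so π divides some member; as F is
-- primary, π does not divide all. If f = πm ∈ F and π ∤ g ∈ F, then m divides g: a common divisor of
-- degree ≥ ℓ of f and g is coprime to π, hence divides m, which has degree ℓ. So, with x the gcd of
-- the members not divisible by π and r = deg x − ℓ, s = d − r, the members divisible by π are πx/p
-- with deg p = r, and the others are xy with deg y = s. Counting, q^d ≤ q^r + q^s. If r = 0, then F
-- consists of all multiples of x; if s = 0, then F = {πx/p : deg p = d} and πx = H_d; otherwise
-- q = 2, d = 2, r = s = 1, which is the exceptional family.
--
-- Irreducible polynomials of degree d exist by counting: summing deg f = ∑ deg P · v_P(f) over all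
-- monic f of degree n gives Gauss's formula ∑_{deg P ∣ n} deg P = q^n, and if no P had degree d, then
-- q^d ≤ ∑_{deg P < d} deg P ≤ q + ⋯ + q^(d−1) < q^d.
module Submission where

open import Level using (0ℓ)
open import Defs
open import Data.Nat as ℕ using (ℕ; zero; suc; _≤_; _<_; _^_; _∸_; z≤n; s≤s)
import Data.Nat.Properties as ℕₚ
open import Data.Nat.Induction using (<-rec)
open import Data.Nat.Solver using (module +-*-Solver)
import Data.Fin.Properties as Fin
open import Data.List using (List; []; _∷_; _++_; length; filter; map; tabulate; removeAt; cartesianProductWith)
import Data.List.Properties as List
open import Data.List.Relation.Unary.All as All using (All; []; _∷_)
import Data.List.Relation.Unary.All.Properties as Allₚ
open import Data.List.Relation.Unary.Any as Any using (Any; here; there)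
import Data.List.Relation.Unary.Any.Properties as Anyₚ
open import Data.List.Relation.Unary.AllPairs as AllPairs using (AllPairs; []; _∷_)
import Data.List.Relation.Unary.AllPairs.Properties as AllPairsₚ
import Data.List.Relation.Unary.Unique.Setoid.Properties as Uniqueₛ
import Data.List.Relation.Unary.Unique.Propositional.Properties as Uniqueₚ
open import Data.List.Membership.Propositional using (_∈_; find)
open import Data.List.Membership.Propositional.Properties using (∈-tabulate⁺; ∈-filter⁺; ∈-filter⁻)
open import Data.Product using (∃; ∃₂; _×_; _,_; proj₁; proj₂)
open import Data.Sum as Sum using (_⊎_; inj₁; inj₂)
open import Data.Empty using (⊥-elim)
open import Function using (_∘_; id)
open import Function.Bundles using (Inverse; mk⇔)
open import Function.Properties.Inverse using (↔⇒↣)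
open import Relation.Unary using (Decidable)
open import Relation.Binary.PropositionalEquality as ≡ using (_≡_; _≢_)
open import Relation.Binary.Definitions using (DecidableEquality; tri<; tri≈; tri>)
open import Relation.Nullary using (¬_; Dec; yes; no; ¬?)
open import Relation.Nullary.Decidable using (map′; _×-dec_; via-injection; decidable-stable)
open import Algebra.Bundles using (CommutativeRing; AbelianGroup; Semiring)
import Algebra.Definitions.RawSemiring
import Algebra.Properties.AbelianGroup
import Algebra.Properties.CommutativeSemigroup
import Algebra.Properties.CommutativeSemigroup.Divisibility
import Algebra.Properties.Group
import Algebra.Properties.Ring
import Algebra.Properties.Semiring.Divisibility
import Algebra.Solver.Ring.NaturalCoefficients.Default
import Relation.Binary.Reasoning.Setoid

-- Gauss's formula comes without Möbius inversion or generating functions. The total exponent of an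
-- irreducible of degree `e` over the monics of degree n is the sum of q^(n - k·e) over k ≥ 1 with
-- k·e ≤ n; passing from n to n + 1 multiplies it by q and adds 1 exactly when e divides n + 1. So
-- the degree count (n + 1)·q^(n+1), minus q times the count n·q^n, isolates the wanted sum and
-- leaves q^(n+1). Primarity is used again at the end. For s = 0 the quotient of πx by H_d divides
-- every member, hence is 1. For r = s = 1 the count is an equality, so every linear p occurs and
-- every linear polynomial divides x; what remains of x after removing X and X + 1 divides every
-- member, hence is 1. For d = 0 the family has one member and is trivial. Polynomials are lists up
-- to coefficientwise equality, so each count is a matching between finite lists: a relation in
-- which no entry serves two others. When the lengths agree, every entry is reached.

-- Matchings between finite lists

module Pigeonhole where
  open ≡ using (refl; sym)

  private variable
    A B : Set

  any-removeAt : ∀ {P Q : B → Set} {ys} (i : Any P ys) → Any Q ys → (∀ {y} → P y → ¬ Q y) →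
    Any Q (removeAt ys (Any.index i))
  any-removeAt (here p)  (here q)  disjoint = ⊥-elim (disjoint p q)
  any-removeAt (here p)  (there j) disjoint = j
  any-removeAt (there i) (here q)  disjoint = here q
  any-removeAt (there i) (there j) disjoint = there (any-removeAt i j disjoint)

  module _ (R : A → B → Set) where

    Disjoint : A → A → Set
    Disjoint x x′ = ∀ y → R x y → ¬ R x′ y

    all-removeAt : ∀ {P : B → Set} {xs ys} (i : Any P ys) → All (λ x → Any (R x) ys) xs →
      All (λ x → ∀ {y} → P y → ¬ R x y) xs → All (λ x → Any (R x) (removeAt ys (Any.index i))) xs
    all-removeAt i []       []       = []
    all-removeAt i (j ∷ js) (d ∷ ds) = any-removeAt i j d ∷ all-removeAt i js ds

    -- Greedy: the partner of the first entry is struck from `ys`, and disjointness keeps a partner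
    -- for every later entry. A relation instead of a function leaves room for equality up to `≈`.
    matching⇒length≤ : ∀ {xs ys} → AllPairs Disjoint xs → All (λ x → Any (R x) ys) xs →
      length xs ≤ length ys
    matching⇒length≤ []       []       = z≤n
    matching⇒length≤ {x ∷ xs} {ys} (d ∷ ds) (i ∷ is) = begin
      suc (length xs)                                  ≤⟨ s≤s (matching⇒length≤ ds (all-removeAt i is d′)) ⟩
      suc (length (removeAt ys (Any.index i)))         ≡⟨ List.length-removeAt′ ys (Any.index i) ⟨
      length ys                                        ∎
      where
      open ℕₚ.≤-Reasoning
      d′ : All (λ x′ → ∀ {y} → R x y → ¬ R x′ y) xs
      d′ = All.map (λ f {y} → f y) d

    -- If nothing were matched to the entry at `i`, that entry could be struck from `ys` too,
    -- leaving fewer places than `xs` has entries. In the uses `P` is equality with a wanted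
    -- element; decidability turns the contradiction into a witness.
    matching-surjective : ∀ {xs ys} → AllPairs Disjoint xs → All (λ x → Any (R x) ys) xs →
      length ys ≤ length xs → ∀ {P : B → Set} → (i : Any P ys) →
      (∀ x → Dec (∃ λ y → P y × R x y)) → Any (λ x → ∃ λ y → P y × R x y) xs
    matching-surjective {xs} {ys} ds is ys≤xs i dec with Any.any? dec xs
    ... | yes found = found
    ... | no none   = ⊥-elim (ℕₚ.<-irrefl refl (begin-strict
      length (removeAt ys (Any.index i))               <⟨ ℕₚ.≤-reflexive (sym (List.length-removeAt′ ys (Any.index i))) ⟩
      length ys                                        ≤⟨ ys≤xs ⟩
      length xs                                        ≤⟨ matching⇒length≤ ds (all-removeAt i is (avoid xs none)) ⟩
      length (removeAt ys (Any.index i))               ∎))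
      where
      open ℕₚ.≤-Reasoning
      avoid : ∀ xs → ¬ Any (λ x → ∃ λ y → _ × R x y) xs → All (λ x → ∀ {y} → _ → ¬ R x y) xs
      avoid []       none = []
      avoid (x ∷ xs) none = (λ {y} p r → none (here (y , p , r))) ∷ avoid xs (none ∘ there)

-- Finite sums and indicators

module Summation where
  open import Data.Nat using (_+_; _*_)
  open ≡ using (refl; sym; trans; cong; cong₂)
  open Algebra.Properties.CommutativeSemigroup ℕₚ.+-commutativeSemigroup using (interchange; x∙yz≈y∙xz)

  private variable
    A B : Set

  ∑ : List A → (A → ℕ) → ℕ
  ∑ []       f = 0
  ∑ (x ∷ xs) f = f x + ∑ xs f

  ∑-cong : ∀ {f g : A → ℕ} {xs} → All (λ x → f x ≡ g x) xs → ∑ xs f ≡ ∑ xs g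
  ∑-cong []       = refl
  ∑-cong (e ∷ es) = cong₂ _+_ e (∑-cong es)

  ∑-mono-≤ : ∀ {f g : A → ℕ} {xs} → All (λ x → f x ≤ g x) xs → ∑ xs f ≤ ∑ xs g
  ∑-mono-≤ []       = z≤n
  ∑-mono-≤ (e ∷ es) = ℕₚ.+-mono-≤ e (∑-mono-≤ es)

  ∑-zero : ∀ (xs : List A) → ∑ xs (λ _ → 0) ≡ 0
  ∑-zero []       = refl
  ∑-zero (x ∷ xs) = ∑-zero xs

  ∑-const : ∀ c (xs : List A) → ∑ xs (λ _ → c) ≡ length xs * c
  ∑-const c []       = refl
  ∑-const c (x ∷ xs) = cong (c +_) (∑-const c xs)

  ∑-+ : ∀ (f g : A → ℕ) xs → ∑ xs (λ x → f x + g x) ≡ ∑ xs f + ∑ xs g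
  ∑-+ f g []       = refl
  ∑-+ f g (x ∷ xs) = trans (cong (f x + g x +_) (∑-+ f g xs)) (interchange (f x) (g x) _ _)

  ∑-*ˡ : ∀ c (f : A → ℕ) xs → ∑ xs (λ x → c * f x) ≡ c * ∑ xs f
  ∑-*ˡ c f []       = sym (ℕₚ.*-zeroʳ c)
  ∑-*ˡ c f (x ∷ xs) = trans (cong (c * f x +_) (∑-*ˡ c f xs)) (sym (ℕₚ.*-distribˡ-+ c (f x) _))

  ∑-++ : ∀ (f : A → ℕ) xs ys → ∑ (xs ++ ys) f ≡ ∑ xs f + ∑ ys f
  ∑-++ f []       ys = refl
  ∑-++ f (x ∷ xs) ys = trans (cong (f x +_) (∑-++ f xs ys)) (sym (ℕₚ.+-assoc (f x) _ _))

  ∑-swap : ∀ (f : A → B → ℕ) xs ys → ∑ xs (λ x → ∑ ys (f x)) ≡ ∑ ys (λ y → ∑ xs (λ x → f x y))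
  ∑-swap f []       ys = sym (∑-zero ys)
  ∑-swap f (x ∷ xs) ys = trans (cong (∑ ys (f x) +_) (∑-swap f xs ys)) (sym (∑-+ (f x) _ ys))

  ⟦_⟧ : ∀ {P : Set} → Dec P → ℕ
  ⟦ yes _ ⟧ = 1
  ⟦ no _  ⟧ = 0

  ⟦⟧-cong : ∀ {P Q : Set} (P? : Dec P) (Q? : Dec Q) → (P → Q) → (Q → P) → ⟦ P? ⟧ ≡ ⟦ Q? ⟧
  ⟦⟧-cong (yes p) (yes q) f g = refl
  ⟦⟧-cong (yes p) (no ¬q) f g = ⊥-elim (¬q (f p))
  ⟦⟧-cong (no ¬p) (yes q) f g = ⊥-elim (¬p (g q))
  ⟦⟧-cong (no ¬p) (no ¬q) f g = refl

  ⟦⟧-yes : ∀ {P : Set} (P? : Dec P) → P → ⟦ P? ⟧ ≡ 1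
  ⟦⟧-yes (yes _) p = refl
  ⟦⟧-yes (no ¬p) p = ⊥-elim (¬p p)

  ⟦⟧-no : ∀ {P : Set} (P? : Dec P) → ¬ P → ⟦ P? ⟧ ≡ 0
  ⟦⟧-no (yes p) ¬p = ⊥-elim (¬p p)
  ⟦⟧-no (no _)  ¬p = refl

  length-filter≡∑ : ∀ {P : A → Set} (P? : Decidable P) xs → length (filter P? xs) ≡ ∑ xs (λ x → ⟦ P? x ⟧)
  length-filter≡∑ P? []       = refl
  length-filter≡∑ P? (x ∷ xs) with P? x
  ... | yes _ = cong suc (length-filter≡∑ P? xs)
  ... | no  _ = length-filter≡∑ P? xs

  -- This is how multiplication by one irreducible acts on the exponents of a polynomial, weighted
  -- by degree: the single entry picked out by `P` gains `w`.
  ∑-bump : ∀ {P : A → Set} {f g : A → ℕ} {w} {xs} → AllPairs (λ x y → P x → ¬ P y) xs →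
    (∀ {x} → P x → f x ≡ w + g x) → All (λ x → ¬ P x → f x ≡ g x) xs → Any P xs →
    ∑ xs f ≡ w + ∑ xs g
  ∑-bump {w = w} {xs = x ∷ xs} (d ∷ ds) hit (m ∷ miss) (here p) =
    trans (cong₂ _+_ (hit p) (∑-cong (rest d miss))) (ℕₚ.+-assoc w _ _)
    where
    rest : ∀ {ys} → All (λ y → _ → ¬ _) ys → All (λ y → _ → _) ys → All _ ys
    rest []        []       = []
    rest (d ∷ ds) (m ∷ ms) = m (d p) ∷ rest ds ms
  ∑-bump {g = g} {w = w} {xs = x ∷ xs} (d ∷ ds) hit (m ∷ miss) (there i) =
    trans (cong₂ _+_ (m λ p → let disjoint , p′ = All.lookupAny d i in disjoint p p′) (∑-bump ds hit miss i))
          (x∙yz≈y∙xz (g x) w _)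

-- Divisibility and coprimality in commutative rings

module Divisibility (R : CommutativeRing 0ℓ 0ℓ) where
  open CommutativeRing R
  open Algebra.Properties.Semiring.Divisibility semiring public
    using (_∣_; _,_; ∣ʳ-trans; ∣ʳ-refl; ∣ʳ-respʳ-≈; ∣ʳ-respˡ-≈)
  open Algebra.Properties.CommutativeSemigroup.Divisibility *-commutativeSemigroup public
    using (x∣xy; x∣ʳyx; x∣y⇒zx∣zy)

  open Algebra.Solver.Ring.NaturalCoefficients.Default commutativeSemiring using (solve; _:=_; _:+_; _:*_)
  open Algebra.Properties.AbelianGroup +-abelianGroup using (xyx⁻¹≈y)
  open Algebra.Properties.Ring ring using (-‿distribˡ-*)

  x∣y⇒x∣zy : ∀ {x y} z → x ∣ y → x ∣ z * y
  x∣y⇒x∣zy z (p , e) = z * p , trans (*-assoc z p _) (*-congˡ e)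

  x∣y⇒x∣yz : ∀ {x y} z → x ∣ y → x ∣ y * z
  x∣y⇒x∣yz z d = ∣ʳ-respʳ-≈ (*-comm z _) (x∣y⇒x∣zy z d)

  x∣y∧x∣z⇒x∣y+z : ∀ {x y z} → x ∣ y → x ∣ z → x ∣ y + z
  x∣y∧x∣z⇒x∣y+z (p , e) (p′ , e′) = p + p′ , trans (distribʳ _ p p′) (+-cong e e′)

  x∣y∧x∣z⇒x∣y-z : ∀ {x y z} → x ∣ y → x ∣ z → x ∣ y - z
  x∣y∧x∣z⇒x∣y-z d (p , e) =
    x∣y∧x∣z⇒x∣y+z d (- p , trans (sym (-‿distribˡ-* p _)) (-‿cong e))

  x≈y+z∧w∣x∧w∣y⇒w∣z : ∀ {w x y z} → x ≈ y + z → w ∣ x → w ∣ y → w ∣ z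
  x≈y+z∧w∣x∧w∣y⇒w∣z {w} {x} {y} {z} e dx dy =
    ∣ʳ-respʳ-≈ (trans (+-congʳ e) (xyx⁻¹≈y y z)) (x∣y∧x∣z⇒x∣y-z dx dy)

  -- As a Bézout identity, coprimality passes to products and powers by ring computation alone,
  -- before any factorization is available.
  Coprime : Carrier → Carrier → Set
  Coprime x y = ∃₂ λ u v → u * x + v * y ≈ 1#

  coprime-divisor : ∀ {x y z} → Coprime x y → x ∣ y * z → x ∣ z
  coprime-divisor {x} {y} {z} (u , v , e) d = ∣ʳ-respʳ-≈ eq
    (x∣y∧x∣z⇒x∣y+z (x∣ʳyx x (u * z)) (x∣y⇒x∣zy v d))
    where
    lemma : ∀ u v x y z → (u * z) * x + v * (y * z) ≈ (u * x + v * y) * z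
    lemma = solve 5 (λ u v x y z → ((u :* z) :* x :+ v :* (y :* z)) := ((u :* x :+ v :* y) :* z)) refl
    eq : (u * z) * x + v * (y * z) ≈ z
    eq = trans (lemma u v x y z) (trans (*-congʳ e) (*-identityˡ z))

  coprime-one : ∀ {y} → Coprime 1# y
  coprime-one {y} = 1# , 0# , trans (+-cong (*-identityˡ 1#) (zeroˡ y)) (+-identityʳ 1#)

  -- The product of the two Bézout identities, with every term except `u * u′ * (x * y)` collected
  -- under `z`.
  coprime-* : ∀ {x y z} → Coprime x z → Coprime y z → Coprime (x * y) z
  coprime-* {x} {y} {z} (u , v , e) (u′ , v′ , e′) = u * u′ , u * x * v′ + v * (u′ * y + v′ * z) ,
    trans (lemma u u′ v v′ x y z) (trans (*-cong e e′) (*-identityˡ 1#))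
    where
    lemma : ∀ u u′ v v′ x y z → u * u′ * (x * y) + (u * x * v′ + v * (u′ * y + v′ * z)) * z
      ≈ (u * x + v * z) * (u′ * y + v′ * z)
    lemma = solve 7 (λ u u′ v v′ x y z →
      (u :* u′ :* (x :* y) :+ (u :* x :* v′ :+ v :* (u′ :* y :+ v′ :* z)) :* z)
        := ((u :* x :+ v :* z) :* (u′ :* y :+ v′ :* z))) refl

  coprime-sym : ∀ {x y} → Coprime x y → Coprime y x
  coprime-sym (u , v , e) = v , u , trans (+-comm _ _) e

  -- In `z = u * x * z + v * y * z` the first summand is a multiple of `x * y` because `y` divides
  -- `z`, the second because `x` does.
  coprime-product : ∀ {x y z} → Coprime x y → x ∣ z → y ∣ z → x * y ∣ z
  coprime-product {x} {y} {z} (u , v , e) (p , px≈z) (p′ , p′y≈z) = u * p′ + v * p , (begin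
    (u * p′ + v * p) * (x * y)                 ≈⟨ lemma u v p p′ x y ⟩
    u * x * (p′ * y) + v * y * (p * x)         ≈⟨ +-cong (*-congˡ p′y≈z) (*-congˡ px≈z) ⟩
    u * x * z + v * y * z                      ≈⟨ distribʳ z _ _ ⟨
    (u * x + v * y) * z                        ≈⟨ *-congʳ e ⟩
    1# * z                                     ≈⟨ *-identityˡ z ⟩
    z                                          ∎)
    where
    open Relation.Binary.Reasoning.Setoid setoid
    lemma : ∀ u v p p′ x y → (u * p′ + v * p) * (x * y) ≈ u * x * (p′ * y) + v * y * (p * x)
    lemma = solve 6 (λ u v p p′ x y →
        ((u :* p′ :+ v :* p) :* (x :* y)) := (u :* x :* (p′ :* y) :+ v :* y :* (p :* x))) refl

-- An abstract 𝔽_q[x], in which Monic n x means that x is monic of degree n.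
record MonicDomain (q : ℕ) : Set₁ where
  field
    commutativeRing : CommutativeRing 0ℓ 0ℓ
  open CommutativeRing commutativeRing
  open Divisibility commutativeRing
  infix 4 _≟_
  field
    Monic             : ℕ → Carrier → Set
    _≟_               : ∀ x y → Dec (x ≈ y)
    monic-resp        : ∀ {n x y} → x ≈ y → Monic n x → Monic n y
    monic-one         : Monic 0 1#
    monic-zero        : ∀ {x} → Monic 0 x → x ≈ 1#
    monic-*           : ∀ {m n x y} → Monic m x → Monic n y → Monic (m ℕ.+ n) (x * y)
    monic-unique      : ∀ {m n x} → Monic m x → Monic n x → m ≡ n
    monic-quotient    : ∀ {m n x y} → Monic m x → Monic n (x * y) → ∃ λ k → n ≡ m ℕ.+ k × Monic k y
    *-cancelˡ         : ∀ {m x y z} → Monic m x → x * y ≈ x * z → y ≈ z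
    -- Degrees are visible only through `Monic`, and a remainder may fail to be monic; a nonzero one
    -- is therefore bounded through a monic associate `z`.
    divide            : ∀ {n x} → Monic n x → ∀ y → ∃₂ λ h r → y ≈ h * x + r ×
                          (r ≈ 0# ⊎ ∃₂ λ k z → k < n × Monic k z × z ∣ r × r ∣ z)
    -- The difference of two monics of degree `n` has degree below `n`, so a `z` of degree at least
    -- `n` divides it only if it is zero.
    monic-diff        : ∀ {m n x y z} → Monic n x → Monic n y → Monic m z → n ≤ m →
                        z ∣ x - y → x ≈ y
    monics            : ℕ → List Carrier
    monics-monic      : ∀ n → All (Monic n) (monics n)
    monics-distinct   : ∀ n → AllPairs (λ x y → ¬ x ≈ y) (monics n)
    monics-complete   : ∀ {n x} → Monic n x → Any (x ≈_) (monics n)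
    length-monics     : ∀ n → length (monics n) ≡ q ^ n
    residues          : ℕ → List Carrier
    length-residues   : ∀ n → length (residues n) ≡ q ^ n
    residues-complete : ∀ {n x} → Monic n x → ∀ y → Any (λ r → x ∣ y - r) (residues n)
    zero-residue      : ∀ n → Any (0# ≈_) (residues n)
    1<q               : 1 < q

-- Euclidean algorithm and irreducible elements

module Irreducibles {q : ℕ} (D : MonicDomain q) where
  open MonicDomain D
  open CommutativeRing commutativeRing
  open Divisibility commutativeRing
  open Algebra.Solver.Ring.NaturalCoefficients.Default commutativeSemiring using (solve; _:=_; _:+_; _:*_)
  open Relation.Binary.Reasoning.Setoid setoid

  monic-quotientʳ : ∀ {m n x z} → Monic m x → Monic n z → x ∣ z →
    ∃₂ λ k y → n ≡ m ℕ.+ k × Monic k y × x * y ≈ z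
  monic-quotientʳ {x = x} mx mz (y , yx≈z) =
    let xy≈z = trans (*-comm x y) yx≈z
        k , n≡m+k , my = monic-quotient mx (monic-resp (sym xy≈z) mz)
    in k , y , n≡m+k , my , xy≈z

  monic-∣⇒≤ : ∀ {m n x y} → Monic m x → Monic n y → x ∣ y → m ≤ n
  monic-∣⇒≤ {m} mx my d with monic-quotientʳ mx my d
  ... | k , _ , n≡m+k , _ = ≡.subst (m ≤_) (≡.sym n≡m+k) (ℕₚ.m≤m+n m k)

  monic-∣⇒≈ : ∀ {m n x y} → Monic m x → Monic n y → n ≤ m → x ∣ y → x ≈ y
  monic-∣⇒≈ {m} {x = x} mx my n≤m d with monic-quotientʳ mx my d
  ... | zero  , z , _     , mz , xz≈y = trans (sym (trans (*-congˡ (monic-zero mz)) (*-identityʳ x))) xz≈y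
  ... | suc k , _ , n≡m+k , _         = ⊥-elim (ℕₚ.m+1+n≰m m (≡.subst (_≤ m) n≡m+k n≤m))

  -- If `x` divided `y`, it would divide the remainder and with it `z`, a monic of smaller degree;
  -- so a nonzero remainder refutes divisibility.
  divides? : ∀ {n x} → Monic n x → ∀ y → Dec (x ∣ y)
  divides? {n} {x} mx y with divide mx y
  ... | h , r , y≈hx+r , inj₁ r≈0 =
    yes (h , sym (trans y≈hx+r (trans (+-congˡ r≈0) (+-identityʳ _))))
  ... | h , r , y≈hx+r , inj₂ (k , z , k<n , mz , z∣r , r∣z) = no λ x∣y →
    ℕₚ.<⇒≱ k<n (monic-∣⇒≤ mx mz
      (∣ʳ-trans (x≈y+z∧w∣x∧w∣y⇒w∣z y≈hx+r x∣y (x∣ʳyx x h)) r∣z))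

  bezout : ∀ {n x} → Monic n x → ∀ y →
    ∃₂ λ m d → Monic m d × d ∣ x × d ∣ y × ∃₂ λ u v → u * x + v * y ≈ d
  bezout {n} {x} mx y = <-rec P step n mx y
    where
    P : ℕ → Set
    P n = ∀ {x} → Monic n x → ∀ y →
      ∃₂ λ m d → Monic m d × d ∣ x × d ∣ y × ∃₂ λ u v → u * x + v * y ≈ d
    step : ∀ n → (∀ {k} → k < n → P k) → P n
    step n rec {x} mx y with divide mx y
    ... | h , r , y≈hx+r , inj₁ r≈0 =
      n , x , mx , ∣ʳ-refl , (h , sym (trans y≈hx+r (trans (+-congˡ r≈0) (+-identityʳ _)))) ,
      1# , 0# , trans (+-cong (*-identityˡ x) (zeroˡ y)) (+-identityʳ x)
    ... | h , r , y≈hx+r , inj₂ (k , z , k<n , mz , z∣r , w , wr≈z) with rec k<n mz x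
    ...   | m , d , md , d∣z , d∣x , u , v , uz+vx≈d =
      m , d , md , d∣x ,
      ∣ʳ-respʳ-≈ (sym y≈hx+r) (x∣y∧x∣z⇒x∣y+z (x∣y⇒x∣zy h d∣x) (∣ʳ-trans d∣z z∣r)) ,
      -- From `u * z + v * x ≈ d` by substituting `w * r` for `z` and `y - h * x` for `r`.
      v - u * w * h , u * w , eq
      where
      open Algebra.Properties.AbelianGroup +-abelianGroup using (xyx⁻¹≈y)
      open Algebra.Properties.Ring ring using (-‿distribˡ-*)
      eq : (v - u * w * h) * x + u * w * y ≈ d
      eq = begin
        (v - u * w * h) * x + u * w * y             ≈⟨ +-cong (distribʳ x v _) (*-congˡ y≈hx+r) ⟩
        v * x + - (u * w * h) * x + u * w * (h * x + r)
          ≈⟨ solve 7 (λ v x a u w h r → ((v :* x :+ a :* x) :+ u :* w :* (h :* x :+ r)) :=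
                (v :* x :+ ((u :* w :* h :* x :+ u :* (w :* r)) :+ a :* x))) refl v x (- (u * w * h)) u w h r ⟩
        v * x + ((u * w * h * x + u * (w * r)) + - (u * w * h) * x)
          ≈⟨ +-congˡ (+-congˡ (-‿distribˡ-* (u * w * h) x)) ⟨
        v * x + ((u * w * h * x + u * (w * r)) + - (u * w * h * x))
          ≈⟨ +-congˡ (xyx⁻¹≈y (u * w * h * x) (u * (w * r))) ⟩
        v * x + u * (w * r)                         ≈⟨ +-comm _ _ ⟩
        u * (w * r) + v * x                         ≈⟨ +-congʳ (*-congˡ wr≈z) ⟩
        u * z + v * x                               ≈⟨ uz+vx≈d ⟩
        d                                           ∎

  gcd-list : ∀ {n xs} → All (Monic n) xs → 0 < length xs →
    ∃₂ λ m d → Monic m d × All (d ∣_) xs × (∀ {c} → All (c ∣_) xs → c ∣ d)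
  gcd-list {n} {x ∷ []} (mx ∷ []) _ = n , x , mx , ∣ʳ-refl ∷ [] , λ { (c∣x ∷ []) → c∣x }
  gcd-list {n} {x ∷ x′ ∷ xs} (mx ∷ ms) _ with gcd-list ms (s≤s z≤n)
  ... | _ , d , md , d∣xs , d-greatest with bezout md x
  ... | m , e , me , e∣d , e∣x , u , v , ud+vx≈e =
    m , e , me , e∣x ∷ All.map (∣ʳ-trans e∣d) d∣xs ,
    λ { (c∣x ∷ c∣xs) → ∣ʳ-respʳ-≈ ud+vx≈e
          (x∣y∧x∣z⇒x∣y+z (x∣y⇒x∣zy u (d-greatest c∣xs)) (x∣y⇒x∣zy v c∣x)) }

  -- Phrased over the finite lists of monics to make irreducibility decidable; `monic-properDivisor`
  -- and `properDivisor⁻` translate to and from arbitrary monic divisors.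
  ProperDivisor : ℕ → Carrier → Set
  ProperDivisor n x = ∃ λ k → k < n × 0 < k × Any (_∣ x) (monics k)

  Irreducible : ℕ → Carrier → Set
  Irreducible n x = Monic n x × 0 < n × ¬ ProperDivisor n x

  properDivisor? : ∀ n x → Dec (ProperDivisor n x)
  properDivisor? n x = ℕₚ.anyUpTo? (λ k → (0 ℕ.<? k) ×-dec any k) n
    where
    anyMonic : ∀ {k ys} → All (Monic k) ys → Dec (Any (_∣ x) ys)
    anyMonic []       = no λ ()
    anyMonic (m ∷ ms) with divides? m x | anyMonic ms
    ... | yes d | _      = yes (here d)
    ... | no _  | yes ds = yes (there ds)
    ... | no ¬d | no ¬ds = no λ { (here d) → ¬d d ; (there ds) → ¬ds ds }
    any : ∀ k → Dec (Any (_∣ x) (monics k))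
    any k = anyMonic (monics-monic k)

  monic-properDivisor : ∀ {n k x y} → k < n → 0 < k → Monic k y → y ∣ x → ProperDivisor n x
  monic-properDivisor k<n 0<k my y∣x =
    _ , k<n , 0<k , Any.map (λ y≈z → ∣ʳ-respˡ-≈ y≈z y∣x) (monics-complete my)

  properDivisor⁻ : ∀ {n x} → ProperDivisor n x → ∃₂ λ k y → k < n × 0 < k × Monic k y × y ∣ x
  properDivisor⁻ (k , k<n , 0<k , d) =
    let my , y∣x = All.lookupAny (monics-monic k) d in k , _ , k<n , 0<k , my , y∣x

  irreducible-resp : ∀ {n x y} → x ≈ y → Irreducible n x → Irreducible n y
  irreducible-resp x≈y (mx , 0<n , prime) =
    monic-resp x≈y mx , 0<n , λ (k , k<n , 0<k , d) →
      prime (k , k<n , 0<k , Any.map (∣ʳ-respʳ-≈ (sym x≈y)) d)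

  irreducibleDivisor : ∀ {n x} → Monic n x → 0 < n → ∃₂ λ k p → Irreducible k p × p ∣ x
  irreducibleDivisor {n} mx 0<n = <-rec P step n mx 0<n
    where
    P : ℕ → Set
    P n = ∀ {x} → Monic n x → 0 < n → ∃₂ λ k p → Irreducible k p × p ∣ x
    step : ∀ n → (∀ {k} → k < n → P k) → P n
    step n rec {x} mx 0<n with properDivisor? n x
    ... | no prime = n , x , (mx , 0<n , prime) , ∣ʳ-refl
    ... | yes pd with properDivisor⁻ pd
    ...   | k , y , k<n , 0<k , my , y∣x with rec k<n my 0<k
    ...     | j , p , irr , p∣y = j , p , irr , ∣ʳ-trans p∣y y∣x

  irreducible-∣⇒≈ : ∀ {m n x p} → Monic (suc m) x → Irreducible n p → x ∣ p → x ≈ p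
  irreducible-∣⇒≈ {m} {n} mx (mp , _ , prime) x∣p with suc m ℕ.<? n
  ... | yes m<n = ⊥-elim (prime (monic-properDivisor m<n (s≤s z≤n) mx x∣p))
  ... | no  m≮n = monic-∣⇒≈ mx mp (ℕₚ.≮⇒≥ m≮n) x∣p

  -- The gcd is a monic divisor of `p`: in degree 0 it is 1 and yields the Bézout identity,
  -- otherwise it is `p` itself.
  irreducible⇒∣⊎coprime : ∀ {n p} → Irreducible n p → ∀ y → p ∣ y ⊎ Coprime p y
  irreducible⇒∣⊎coprime irr y with bezout (proj₁ irr) y
  ... | zero  , d , md , _   , _   , u , v , e = inj₂ (u , v , trans e (monic-zero md))
  ... | suc m , d , md , d∣p , d∣y , _         = inj₁ (∣ʳ-respˡ-≈ (irreducible-∣⇒≈ md irr d∣p) d∣y)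

-- Gauss's formula and irreducibles of every degree

module ExistenceOfIrreducibles {q : ℕ} (D : MonicDomain q) where
  open MonicDomain D
  open CommutativeRing commutativeRing using
    (Carrier; _≈_; _*_; refl; sym; trans; *-congˡ; *-congʳ; *-comm; *-identityʳ; commutativeSemiring; semiring)
  open Divisibility commutativeRing
  open Irreducibles D
  open Pigeonhole
  open Summation
  open Algebra.Definitions.RawSemiring (Semiring.rawSemiring semiring) using () renaming (_^_ to _^ᴿ_)

  -- q ^ (n ∸ m) if m ≤ n, and 0 otherwise.
  multiples : ℕ → ℕ → ℕ
  multiples n       zero    = q ^ n
  multiples zero    (suc m) = 0
  multiples (suc n) (suc m) = multiples n m

  multiples-+ : ∀ m k → multiples (m ℕ.+ k) m ≡ q ^ k
  multiples-+ zero    k = ≡.refl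
  multiples-+ (suc m) k = multiples-+ m k

  multiples-< : ∀ {n m} → n < m → multiples n m ≡ 0
  multiples-< {zero}  (s≤s _)   = ≡.refl
  multiples-< {suc n} (s≤s n<m) = multiples-< n<m

  -- From `n` to `n + 1` the count grows by the factor `q`, except that a divisor of degree exactly
  -- `n + 1` goes from no multiple to one. This correction is the source of Gauss's formula.
  multiples-suc : ∀ n m → multiples (suc n) m ≡ q ℕ.* multiples n m ℕ.+ ⟦ m ℕ.≟ suc n ⟧
  multiples-suc n       zero          = ≡.sym (ℕₚ.+-identityʳ _)
  multiples-suc zero    (suc zero)    = ≡.cong (ℕ._+ 1) (≡.sym (ℕₚ.*-zeroʳ q))
  multiples-suc zero    (suc (suc m)) = ≡.cong (ℕ._+ 0) (≡.sym (ℕₚ.*-zeroʳ q))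
  multiples-suc (suc n) (suc m)       = ≡.trans (multiples-suc n m) (≡.cong (q ℕ.* multiples n m ℕ.+_)
    (⟦⟧-cong (m ℕ.≟ suc n) (suc m ℕ.≟ suc (suc n)) (≡.cong suc) ℕₚ.suc-injective))

  -- For `n = m + k`, multiplication by `a` is a bijection from the monics of degree `k`, used as
  -- one matching in each direction; its injectivity is cancellation of `a`.
  count-multiples : ∀ {m a} (ma : Monic m a) n →
    length (filter (divides? ma) (monics n)) ≡ multiples n m
  count-multiples {m} {a} ma n with m ℕ.≤? n
  ... | no m≰n = ≡.trans (≡.cong length (List.filter-none (divides? ma)
                   (All.map (λ mx d → m≰n (monic-∣⇒≤ ma mx d)) (monics-monic n))))
                 (≡.sym (multiples-< (ℕₚ.≰⇒> m≰n)))
  ... | yes m≤n with ℕₚ.m≤n⇒∃[o]m+o≡n m≤n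
  ...   | k , ≡.refl = ≡.trans (ℕₚ.≤-antisym ≤₁ ≤₂) (≡.trans (length-monics k) (≡.sym (multiples-+ m k)))
    where
    n′ = m ℕ.+ k
    ≤₁ : length (filter (divides? ma) (monics n′)) ≤ length (monics k)
    ≤₁ = matching⇒length≤ (λ x y → a * y ≈ x)
      (AllPairs.map (λ x≉x′ _ e e′ → x≉x′ (trans (sym e) e′))
        (AllPairsₚ.filter⁺ (divides? ma) (monics-distinct n′)))
      (All.zipWith (λ (mx , d) → cofactor mx d)
        (Allₚ.filter⁺ (divides? ma) (monics-monic n′) , Allₚ.all-filter (divides? ma) (monics n′)))
      where
      cofactor : ∀ {x} → Monic n′ x → a ∣ x → Any (λ y → a * y ≈ x) (monics k)
      cofactor mx d with monic-quotientʳ ma mx d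
      ... | j , y , e , my , ay≈x with ℕₚ.+-cancelˡ-≡ m k j e
      ...   | ≡.refl = Any.map (λ y≈z → trans (*-congˡ (sym y≈z)) ay≈x) (monics-complete my)
    ≤₂ : length (monics k) ≤ length (filter (divides? ma) (monics n′))
    ≤₂ = matching⇒length≤ (λ y x → a * y ≈ x)
      (AllPairs.map (λ y≉y′ _ e e′ → y≉y′ (*-cancelˡ ma (trans e (sym e′)))) (monics-distinct k))
      (All.map multiple (monics-monic k))
      where
      multiple : ∀ {y} → Monic k y → Any (λ x → a * y ≈ x) (filter (divides? ma) (monics n′))
      multiple {y} my with Anyₚ.filter⁺ (divides? ma) (monics-complete (monic-* ma my))
      ... | inj₁ found = found
      ... | inj₂ a∤    = ⊥-elim
          (a∤ (∣ʳ-respʳ-≈ (Anyₚ.lookup-result (monics-complete (monic-* ma my))) (x∣xy a y)))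

  Prime : Set
  Prime = ∃₂ Irreducible

  degree : Prime → ℕ
  degree = proj₁

  element : Prime → Carrier
  element = proj₁ ∘ proj₂

  degree>0 : ∀ P → 0 < degree P
  degree>0 (_ , _ , _ , 0<e , _) = 0<e

  monic-^ : ∀ (P : Prime) k → Monic (k ℕ.* degree P) (element P ^ᴿ k)
  monic-^ P         zero    = monic-one
  monic-^ P@(e , p , mp , _) (suc k) = monic-* mp (monic-^ P k)

  power∣? : ∀ (P : Prime) k x → Dec (element P ^ᴿ k ∣ x)
  power∣? P k = divides? (monic-^ P k)

  -- The exponent of P in x, truncated at N.
  valuation : ℕ → Prime → Carrier → ℕ
  valuation zero    P x = 0
  valuation (suc N) P x = valuation N P x ℕ.+ ⟦ power∣? P (suc N) x ⟧

  valuation-cong : ∀ N P {x y} → (∀ k → element P ^ᴿ suc k ∣ x → element P ^ᴿ suc k ∣ y) →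
    (∀ k → element P ^ᴿ suc k ∣ y → element P ^ᴿ suc k ∣ x) → valuation N P x ≡ valuation N P y
  valuation-cong zero    P         f g = ≡.refl
  valuation-cong (suc N) P {x} {y} f g = ≡.cong₂ ℕ._+_ (valuation-cong N P f g)
    (⟦⟧-cong (power∣? P (suc N) x) (power∣? P (suc N) y) (f N) (g N))

  n≤n*degree : ∀ P n → n ≤ n ℕ.* degree P
  n≤n*degree (e , _ , _ , 0<e , _) n = ℕₚ.m≤m*n n e {{ℕ.>-nonZero 0<e}}

  power∤ : ∀ P {k n x} → Monic n x → n < k → ¬ element P ^ᴿ k ∣ x
  power∤ P {k} mx n<k d =
    ℕₚ.<⇒≱ n<k (ℕₚ.≤-trans (n≤n*degree P k) (monic-∣⇒≤ (monic-^ P k) mx d))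

  valuation-one : ∀ N P {x} → Monic 0 x → valuation N P x ≡ 0
  valuation-one zero    P mx = ≡.refl
  valuation-one (suc N) P {x} mx = ≡.cong₂ ℕ._+_ (valuation-one N P mx)
    (⟦⟧-no (power∣? P (suc N) x) (power∤ P {suc N} mx (s≤s z≤n)))

  -- Irreducibles have positive degree, so a power with exponent above `n` has degree above `n`:
  -- truncating at `N ≥ n` loses nothing.
  valuation-suc : ∀ N P {n x} → Monic n x → n ≤ N → valuation (suc N) P x ≡ valuation N P x
  valuation-suc N P {x = x} mx n≤N = ≡.trans
    (≡.cong (valuation N P x ℕ.+_) (⟦⟧-no (power∣? P (suc N) x) (power∤ P mx (s≤s n≤N))))
    (ℕₚ.+-identityʳ _)

  private
    -- For `p = element P`, `p ^ (k + 1)` divides `p * y` exactly when `p ^ k` divides `y`, so the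
    -- indicators move by one place; the new first one is 1 because `p` divides `x`.
    valuation-shift : ∀ N P {x y} → element P * y ≈ x → valuation (suc N) P x ≡ suc (valuation N P y)
    valuation-shift zero    P {x} {y} e = ⟦⟧-yes (power∣? P 1 x)
      (y , trans (*-comm y _) (trans (*-congʳ (*-identityʳ _)) e))
    valuation-shift (suc N) P {x} {y} e = ≡.cong₂ ℕ._+_ (valuation-shift N P e)
      (⟦⟧-cong (power∣? P (suc (suc N)) x) (power∣? P (suc N) y) down up)
      where
      p = element P
      mp = proj₁ (proj₂ (proj₂ P))
      down : p ^ᴿ suc (suc N) ∣ x → p ^ᴿ suc N ∣ y
      down (h , e′) = h , *-cancelˡ mp (trans (lemma p h (p ^ᴿ suc N)) (trans e′ (sym e)))
        where
        open Algebra.Solver.Ring.NaturalCoefficients.Default commutativeSemiring using (solve; _:=_; _:*_)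
        lemma : ∀ p h r → p * (h * r) ≈ h * (p * r)
        lemma = solve 3 (λ p h r → (p :* (h :* r)) := (h :* (p :* r))) refl
      up : p ^ᴿ suc N ∣ y → p ^ᴿ suc (suc N) ∣ x
      up d = ∣ʳ-respʳ-≈ e (x∣y⇒zx∣zy {p ^ᴿ suc N} p d)

  valuation-hit : ∀ N P {n x y} → Monic n y → n < N → element P * y ≈ x →
    valuation N P x ≡ suc (valuation N P y)
  valuation-hit (suc N) P my (s≤s n≤N) e =
    ≡.trans (valuation-shift N P e) (≡.cong suc (≡.sym (valuation-suc N P my n≤N)))

  coprime-^ : ∀ {x y} k → Coprime x y → Coprime (x ^ᴿ k) y
  coprime-^ zero    c = coprime-one
  coprime-^ (suc k) c = coprime-* c (coprime-^ k c)

  -- Distinct monic irreducibles are coprime, and a power of the one stays coprime to the other; so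
  -- a power of `element P` that divides `p * y` divides `y`.
  valuation-miss : ∀ N P {n p x y} → Irreducible n p → ¬ element P ≈ p → p * y ≈ x →
    valuation N P x ≡ valuation N P y
  valuation-miss N P@(suc e , r , irr) {p = p} {y = y} irr′ r≉p py≈x with irreducible⇒∣⊎coprime irr p
  ... | inj₁ r∣p = ⊥-elim (r≉p (irreducible-∣⇒≈ (proj₁ irr) irr′ r∣p))
  ... | inj₂ c   = valuation-cong N P
    (λ k d → coprime-divisor (coprime-^ (suc k) c) (∣ʳ-respʳ-≈ (sym py≈x) d))
    (λ k d → ∣ʳ-respʳ-≈ py≈x (x∣y⇒x∣zy p d))
  valuation-miss N (zero , r , _ , () , _) irr′ r≉p py≈x

  irreducibles : ∀ {n xs} → 0 < n → All (Monic n) xs → List (∃ (Irreducible n))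
  irreducibles         0<n []                = []
  irreducibles {n} {x ∷ xs} 0<n (mx ∷ ms) with properDivisor? n x
  ... | yes _    = irreducibles 0<n ms
  ... | no prime = (x , mx , 0<n , prime) ∷ irreducibles 0<n ms

  irreducibles-all : ∀ {n xs} {Q : Carrier → Set} (0<n : 0 < n) (ms : All (Monic n) xs) →
    All Q xs → All (Q ∘ proj₁) (irreducibles 0<n ms)
  irreducibles-all 0<n []        []       = []
  irreducibles-all {n} {x ∷ xs} 0<n (mx ∷ ms) (q ∷ qs) with properDivisor? n x
  ... | yes _ = irreducibles-all 0<n ms qs
  ... | no _  = q ∷ irreducibles-all 0<n ms qs

  irreducibles-distinct : ∀ {n xs} (0<n : 0 < n) (ms : All (Monic n) xs) →
    AllPairs (λ x y → ¬ x ≈ y) xs → AllPairs (λ P Q → ¬ proj₁ P ≈ proj₁ Q) (irreducibles 0<n ms)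
  irreducibles-distinct 0<n []        []       = []
  irreducibles-distinct {n} {x ∷ xs} 0<n (mx ∷ ms) (d ∷ ds) with properDivisor? n x
  ... | yes _ = irreducibles-distinct 0<n ms ds
  ... | no _  = irreducibles-all 0<n ms d ∷ irreducibles-distinct 0<n ms ds

  irreducibles-complete : ∀ {n p xs} (0<n : 0 < n) (ms : All (Monic n) xs) → Irreducible n p →
    Any (p ≈_) xs → Any (λ P → proj₁ P ≈ p) (irreducibles 0<n ms)
  irreducibles-complete {n} {xs = x ∷ xs} 0<n (mx ∷ ms) irr i with properDivisor? n x
  irreducibles-complete 0<n (mx ∷ ms) irr (here p≈x) | yes d =
    ⊥-elim (proj₂ (proj₂ (irreducible-resp p≈x irr)) d)
  irreducibles-complete 0<n (mx ∷ ms) irr (there i)  | yes _ = irreducibles-complete 0<n ms irr i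
  irreducibles-complete 0<n (mx ∷ ms) irr (here p≈x) | no _  = here (sym p≈x)
  irreducibles-complete 0<n (mx ∷ ms) irr (there i)  | no _  = there (irreducibles-complete 0<n ms irr i)

  primesOfDegree : ∀ n → List (∃ (Irreducible (suc n)))
  primesOfDegree n = irreducibles (s≤s z≤n) (monics-monic (suc n))

  -- `N` bounds the degree. The block of top degree stands first, so that it can be split off from
  -- the sums below.
  primes : ℕ → List Prime
  primes zero    = []
  primes (suc N) = map (suc N ,_) (primesOfDegree N) ++ primes N

  primes-degree≤ : ∀ N → All (λ P → degree P ≤ N) (primes N)
  primes-degree≤ zero    = []
  primes-degree≤ (suc N) = Allₚ.++⁺ (Allₚ.map⁺ (All.universal (λ _ → ℕₚ.≤-refl) _))
    (All.map ℕₚ.m≤n⇒m≤1+n (primes-degree≤ N))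

  primes-distinct : ∀ N → AllPairs (λ P Q → ¬ element P ≈ element Q) (primes N)
  primes-distinct zero    = []
  primes-distinct (suc N) = AllPairsₚ.++⁺
    (AllPairsₚ.map⁺ (irreducibles-distinct (s≤s z≤n) (monics-monic (suc N)) (monics-distinct (suc N))))
    (primes-distinct N)
    (Allₚ.map⁺ (All.universal (λ (p , mp , _) → All.map (λ {Q} Q≤N p≈Q →
       ℕₚ.<-irrefl (monic-unique (monic-resp (sym p≈Q) (proj₁ (proj₂ (proj₂ Q)))) mp) (s≤s Q≤N))
       (primes-degree≤ N)) _))

  primes-complete : ∀ N {n p} → Irreducible n p → n ≤ N → Any (λ P → element P ≈ p) (primes N)
  primes-complete zero    irr n≤0 = ⊥-elim (ℕₚ.<⇒≱ (proj₁ (proj₂ irr)) n≤0)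
  primes-complete (suc N) irr n≤1+N with ℕₚ.m≤n⇒m<n∨m≡n n≤1+N
  ... | inj₁ n<1+N  = Anyₚ.++⁺ʳ _ (primes-complete N irr (ℕ.s≤s⁻¹ n<1+N))
  ... | inj₂ ≡.refl = Anyₚ.++⁺ˡ (Anyₚ.map⁺
    (irreducibles-complete (s≤s z≤n) (monics-monic (suc N)) irr (monics-complete (proj₁ irr))))

  -- Strong induction on the degree: cancelling an irreducible divisor `p` lowers the exponent of
  -- `p` by one and changes no other. `N` stays fixed throughout, so one list of primes serves all
  -- degrees.
  degree≡∑valuations : ∀ {N n x} → Monic n x → n ≤ N →
    ∑ (primes N) (λ P → degree P ℕ.* valuation N P x) ≡ n
  degree≡∑valuations {N} {n} mx n≤N = <-rec Q step n mx n≤N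
    where
    Q : ℕ → Set
    Q n = ∀ {x} → Monic n x → n ≤ N → ∑ (primes N) (λ P → degree P ℕ.* valuation N P x) ≡ n
    step : ∀ n → (∀ {k} → k < n → Q k) → Q n
    step zero    rec mx n≤N = ≡.trans
      (∑-cong (All.universal (λ P → ≡.trans (≡.cong (degree P ℕ.*_) (valuation-one N P mx))
          (ℕₚ.*-zeroʳ (degree P))) (primes N)))
      (∑-zero (primes N))
    step (suc n) rec {x} mx n≤N with irreducibleDivisor mx (s≤s z≤n)
    ... | e , p , irr@(mp , 0<e , _) , p∣x with monic-quotientʳ mp mx p∣x
    ...   | j , y , n≡e+j , my , py≈x = ≡.trans
      (∑-bump (AllPairs.map (λ P≉Q P≈p Q≈p → P≉Q (trans P≈p (sym Q≈p))) (primes-distinct N))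
        (λ {P} → hit P)
        (All.universal (λ P P≉p → ≡.cong (degree P ℕ.*_) (valuation-miss N P irr P≉p py≈x)) (primes N))
        (primes-complete N irr (ℕₚ.≤-trans (ℕₚ.m≤m+n e j) (ℕₚ.≤-trans (ℕₚ.≤-reflexive (≡.sym n≡e+j)) n≤N))))
      (≡.trans (≡.cong (e ℕ.+_) (rec j<n my (ℕₚ.<⇒≤ (ℕₚ.<-≤-trans j<n n≤N)))) (≡.sym n≡e+j))
      where
      j<n : j < suc n
      j<n = ≡.subst (j <_) (≡.sym n≡e+j) (ℕₚ.m<n+m j 0<e)
      hit : ∀ P → element P ≈ p → degree P ℕ.* valuation N P x ≡ e ℕ.+ degree P ℕ.* valuation N P y
      hit P P≈p = ≡.trans
        (≡.cong (degree P ℕ.*_) (valuation-hit N P my (ℕₚ.<-≤-trans j<n n≤N) (trans (*-congʳ P≈p) py≈x)))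
        (≡.trans (ℕₚ.*-suc (degree P) _)
          (≡.cong (ℕ._+ degree P ℕ.* valuation N P y)
            (monic-unique (proj₁ (proj₂ (proj₂ P))) (monic-resp (sym P≈p) mp))))

  -- The total exponent of a prime of degree `e` over all monics of degree `n`, by counting the
  -- multiples of its k-th power for k from 1 to `N`. The prime enters only through `e`.
  totalValuation : ℕ → ℕ → ℕ → ℕ
  totalValuation n e zero    = 0
  totalValuation n e (suc N) = totalValuation n e N ℕ.+ multiples n (suc N ℕ.* e)

  ∑-valuation : ∀ n N P → ∑ (monics n) (valuation N P) ≡ totalValuation n (degree P) N
  ∑-valuation n zero    P = ∑-zero (monics n)
  ∑-valuation n (suc N) P = ≡.trans (∑-+ (valuation N P) _ (monics n)) (≡.cong₂ ℕ._+_ (∑-valuation n N P)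
    (≡.trans (≡.sym (length-filter≡∑ (power∣? P (suc N)) (monics n))) (count-multiples (monic-^ P (suc N)) n)))

  ∑-totalValuation : ∀ {n N} → n ≤ N →
    ∑ (primes N) (λ P → degree P ℕ.* totalValuation n (degree P) N) ≡ q ^ n ℕ.* n
  ∑-totalValuation {n} {N} n≤N = begin
    ∑ (primes N) (λ P → degree P ℕ.* totalValuation n (degree P) N)
      ≡⟨ ∑-cong (All.universal (λ P → ≡.trans (≡.cong (degree P ℕ.*_) (≡.sym (∑-valuation n N P)))
           (≡.sym (∑-*ˡ (degree P) (valuation N P) (monics n)))) (primes N)) ⟩
    ∑ (primes N) (λ P → ∑ (monics n) (λ x → degree P ℕ.* valuation N P x))
      ≡⟨ ∑-swap (λ P x → degree P ℕ.* valuation N P x) (primes N) (monics n) ⟩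
    ∑ (monics n) (λ x → ∑ (primes N) (λ P → degree P ℕ.* valuation N P x))
      ≡⟨ ∑-cong (All.map (λ mx → degree≡∑valuations mx n≤N) (monics-monic n)) ⟩
    ∑ (monics n) (λ _ → n)
      ≡⟨ ∑-const n (monics n) ⟩
    length (monics n) ℕ.* n
      ≡⟨ ≡.cong (ℕ._* n) (length-monics n) ⟩
    q ^ n ℕ.* n ∎
    where open ≡.≡-Reasoning

  -- For N ≥ n > 0 this is 1 if e divides n, and 0 otherwise.
  divisibility : ℕ → ℕ → ℕ → ℕ
  divisibility n e zero    = 0
  divisibility n e (suc N) = divisibility n e N ℕ.+ ⟦ suc N ℕ.* e ℕ.≟ n ⟧

  -- The corrections in `multiples-suc` at the degrees `k * e` of the powers add up, over k, to
  -- `divisibility`.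
  totalValuation-suc : ∀ n e N → totalValuation (suc n) e N ≡ q ℕ.* totalValuation n e N ℕ.+
      divisibility (suc n) e N
  totalValuation-suc n e zero    = ≡.trans (≡.sym (ℕₚ.*-zeroʳ q)) (≡.sym (ℕₚ.+-identityʳ _))
  totalValuation-suc n e (suc N) = begin
    totalValuation (suc n) e N ℕ.+ multiples (suc n) m
      ≡⟨ ≡.cong₂ ℕ._+_ (totalValuation-suc n e N) (multiples-suc n m) ⟩
    (q ℕ.* totalValuation n e N ℕ.+ divisibility (suc n) e N) ℕ.+ (q ℕ.* multiples n m ℕ.+ ⟦ m ℕ.≟ suc n ⟧)
      ≡⟨ interchange (q ℕ.* totalValuation n e N) _ _ _ ⟩
    (q ℕ.* totalValuation n e N ℕ.+ q ℕ.* multiples n m) ℕ.+ (divisibility (suc n) e N ℕ.+ ⟦ m ℕ.≟ suc n ⟧)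
      ≡⟨ ≡.cong (ℕ._+ divisibility (suc n) e (suc N)) (ℕₚ.*-distribˡ-+ q (totalValuation n e N) _) ⟨
    q ℕ.* totalValuation n e (suc N) ℕ.+ divisibility (suc n) e (suc N) ∎
    where
    open ≡.≡-Reasoning
    open Algebra.Properties.CommutativeSemigroup ℕₚ.+-commutativeSemigroup using (interchange)
    m = suc N ℕ.* e

  -- Gauss's formula: the degrees of the monic irreducibles of degree dividing n + 1 add up to qⁿ⁺¹.
  gauss : ∀ {n N} → suc n ≤ N → ∑ (primes N) (λ P → degree P ℕ.* divisibility (suc n) (degree P) N) ≡ q ^ suc n
  gauss {n} {N} n<N = ℕₚ.+-cancelˡ-≡ (q ℕ.* (q ^ n ℕ.* n)) _ _ (begin
    -- Cancellation stands in for subtracting `q` times the identity for `n` from that for `n + 1`.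
    -- Both run over the same `primes N`, so they combine prime by prime.
    q ℕ.* (q ^ n ℕ.* n) ℕ.+ ∑ (primes N) f
      ≡⟨ ≡.cong (λ s → q ℕ.* s ℕ.+ ∑ (primes N) f) (∑-totalValuation (ℕₚ.<⇒≤ n<N)) ⟨
    q ℕ.* ∑ (primes N) (λ P → degree P ℕ.* totalValuation n (degree P) N) ℕ.+ ∑ (primes N) f
      ≡⟨ ≡.cong (ℕ._+ ∑ (primes N) f) (∑-*ˡ q _ (primes N)) ⟨
    ∑ (primes N) (λ P → q ℕ.* (degree P ℕ.* totalValuation n (degree P) N)) ℕ.+ ∑ (primes N) f
    ≡⟨ ∑-+ (λ P → q ℕ.* (degree P ℕ.* totalValuation n (degree P) N)) _ (primes N) ⟨
    ∑ (primes N) (λ P → q ℕ.* (degree P ℕ.* totalValuation n (degree P) N) ℕ.+ degree P ℕ.*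
        divisibility (suc n) (degree P) N)
      ≡⟨ ∑-cong (All.universal (λ P → ≡.sym (step (degree P))) (primes N)) ⟩
    ∑ (primes N) (λ P → degree P ℕ.* totalValuation (suc n) (degree P) N)
      ≡⟨ ∑-totalValuation n<N ⟩
    q ^ suc n ℕ.* suc n
      ≡⟨ solve 3 (λ q r n → (q :* r) :* (con 1 :+ n) := q :* (r :* n) :+ q :* r) ≡.refl q (q ^ n) n ⟩
    q ℕ.* (q ^ n ℕ.* n) ℕ.+ q ^ suc n ∎)
    where
    open ≡.≡-Reasoning
    open +-*-Solver
    f : Prime → ℕ
    f P = degree P ℕ.* divisibility (suc n) (degree P) N
    step : ∀ e → e ℕ.* totalValuation (suc n) e N ≡ q ℕ.* (e ℕ.* totalValuation n e N) ℕ.+ e ℕ.*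
        divisibility (suc n) e N
    step e = ≡.trans (≡.cong (e ℕ.*_) (totalValuation-suc n e N))
      (solve 4 (λ e q t d → e :* (q :* t :+ d) := q :* (e :* t) :+ e :* d) ≡.refl e q (totalValuation n e N) _)

  divisibility-zero : ∀ {n e} N → N ℕ.* e < n → divisibility n e N ≡ 0
  divisibility-zero zero    _ = ≡.refl
  divisibility-zero {n} {e} (suc N) Ne<n = ≡.cong₂ ℕ._+_
    (divisibility-zero N (ℕₚ.≤-<-trans (ℕₚ.m≤n+m (N ℕ.* e) e) Ne<n))
    (⟦⟧-no (suc N ℕ.* e ℕ.≟ n) (ℕₚ.<⇒≢ Ne<n))

  -- The multiples of a positive `e` increase strictly, so when one of them equals `n` all earlier
  -- ones fall short.
  divisibility≤1 : ∀ {n e} N → 0 < e → divisibility n e N ≤ 1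
  divisibility≤1 zero    0<e = z≤n
  divisibility≤1 {n} {e} (suc N) 0<e with suc N ℕ.* e ℕ.≟ n
  ... | yes Ne≡n = ℕₚ.≤-reflexive (≡.cong (ℕ._+ 1)
                     (divisibility-zero N (≡.subst (N ℕ.* e <_) Ne≡n (ℕₚ.m<n+m (N ℕ.* e) 0<e))))
  ... | no _     = ≡.subst (_≤ 1) (≡.sym (ℕₚ.+-identityʳ _)) (divisibility≤1 N 0<e)

  divisibility≥1 : ∀ n N → 1 ≤ divisibility n n (suc N)
  divisibility≥1 n zero    = ℕₚ.≤-reflexive (≡.sym (⟦⟧-yes (1 ℕ.* n ℕ.≟ n) (ℕₚ.*-identityˡ n)))
  divisibility≥1 n (suc N) = ℕₚ.≤-trans (divisibility≥1 n N) (ℕₚ.m≤m+n _ _)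

  -- Gauss's formula for `n + 1` counts these primes with weight at least 1, and its other terms are
  -- nonnegative.
  ∑-primesOfDegree≤ : ∀ n → ∑ (map (suc n ,_) (primesOfDegree n)) degree ≤ q ^ suc n
  ∑-primesOfDegree≤ n = begin
    ∑ (map (suc n ,_) (primesOfDegree n)) degree
      ≤⟨ ∑-mono-≤ (Allₚ.map⁺ (All.universal (λ _ →
           ℕₚ.≤-trans (ℕₚ.≤-reflexive (≡.sym (ℕₚ.*-identityʳ (suc n))))
               (ℕₚ.*-monoʳ-≤ (suc n) (divisibility≥1 (suc n) n))) (primesOfDegree n))) ⟩
    ∑ (map (suc n ,_) (primesOfDegree n)) w
      ≤⟨ ℕₚ.m≤m+n _ _ ⟩
    ∑ (map (suc n ,_) (primesOfDegree n)) w ℕ.+ ∑ (primes n) w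
      ≡⟨ ∑-++ w (map (suc n ,_) (primesOfDegree n)) (primes n) ⟨
    ∑ (primes (suc n)) w
      ≡⟨ gauss ℕₚ.≤-refl ⟩
    q ^ suc n ∎
    where
    open ℕₚ.≤-Reasoning
    w : Prime → ℕ
    w P = degree P ℕ.* divisibility (suc n) (degree P) (suc n)

  -- The geometric series folded into one induction: each step needs only that twice `q ^ suc n` is
  -- at most `q ^ suc (suc n)`.
  ∑-primes< : ∀ n → ∑ (primes n) degree < q ^ suc n
  ∑-primes< zero    = ℕₚ.<-≤-trans (ℕₚ.<-trans (s≤s z≤n) 1<q) (ℕₚ.≤-reflexive (≡.sym (ℕₚ.*-identityʳ q)))
  ∑-primes< (suc n) = begin-strict
    ∑ (primes (suc n)) degree
      ≡⟨ ∑-++ degree (map (suc n ,_) (primesOfDegree n)) (primes n) ⟩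
    ∑ (map (suc n ,_) (primesOfDegree n)) degree ℕ.+ ∑ (primes n) degree
      <⟨ ℕₚ.+-mono-≤-< (∑-primesOfDegree≤ n) (∑-primes< n) ⟩
    q ^ suc n ℕ.+ q ^ suc n
      ≡⟨ ≡.cong (q ^ suc n ℕ.+_) (ℕₚ.+-identityʳ _) ⟨
    2 ℕ.* q ^ suc n
      ≤⟨ ℕₚ.*-monoˡ-≤ (q ^ suc n) 1<q ⟩
    q ^ suc (suc n) ∎
    where open ℕₚ.≤-Reasoning

  irreducible-exists : ∀ {n} → 0 < n → ∃ (Irreducible n)
  irreducible-exists {suc n} _ with primesOfDegree n in eq
  ... | P ∷ _ = P
  ... | []    = ⊥-elim (ℕₚ.<-irrefl ≡.refl (begin-strict
    q ^ suc n
      ≡⟨ gauss ℕₚ.≤-refl ⟨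
    ∑ (map (suc n ,_) (primesOfDegree n) ++ primes n) w
      ≡⟨ ≡.cong (λ ps → ∑ (map (suc n ,_) ps ++ primes n) w) eq ⟩
    ∑ (primes n) w
      ≤⟨ ∑-mono-≤ (All.universal
          (λ P → ℕₚ.≤-trans (ℕₚ.*-monoʳ-≤ (degree P) (divisibility≤1 (suc n) (degree>0 P)))
          (ℕₚ.≤-reflexive (ℕₚ.*-identityʳ (degree P)))) (primes n)) ⟩
    ∑ (primes n) degree
      <⟨ ∑-primes< n ⟩
    q ^ suc n ∎))
    where
    open ℕₚ.≤-Reasoning
    w : Prime → ℕ
    w P = degree P ℕ.* divisibility (suc n) (degree P) (suc n)

-- Auxiliary facts on lists

module ListLemmas where
  private variable
    A : Set

  allPairs-zip : ∀ {P : A → Set} {R : A → A → Set} {xs} → All P xs → AllPairs R xs →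
    AllPairs (λ x y → P x × P y × R x y) xs
  allPairs-zip []       []       = []
  allPairs-zip (p ∷ ps) (r ∷ rs) = All.zipWith (λ (p′ , r) → p , p′ , r) (ps , r) ∷ allPairs-zip ps rs

  length-filter-¬ : ∀ {P : A → Set} (P? : Decidable P) xs →
    length xs ≡ length (filter P? xs) ℕ.+ length (filter (¬? ∘ P?) xs)
  length-filter-¬ P? []       = ≡.refl
  length-filter-¬ P? (x ∷ xs) with P? x
  ... | yes _ = ≡.cong suc (length-filter-¬ P? xs)
  ... | no  _ = ≡.trans (≡.cong suc (length-filter-¬ P? xs)) (≡.sym (ℕₚ.+-suc _ _))

  ∈⇒0<length : ∀ {x : A} {xs} → x ∈ xs → 0 < length xs
  ∈⇒0<length (here _)  = s≤s z≤n
  ∈⇒0<length (there _) = s≤s z≤n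

-- When a power is at most a sum of two powers

module Arithmetic where
  -- The two sides differ by `x * y`, the product of the predecessors.
  x+y≤xy+1 : ∀ x y → suc x ℕ.+ suc y ≤ suc x ℕ.* suc y ℕ.+ 1
  x+y≤xy+1 x y = begin
    suc x ℕ.+ suc y                  ≤⟨ ℕₚ.m≤m+n _ (x ℕ.* y) ⟩
    suc x ℕ.+ suc y ℕ.+ x ℕ.* y      ≡⟨ solve 2 (λ x y → (con 1 :+ x) :+ (con 1 :+ y) :+ x :* y
                                          := (con 1 :+ x) :* (con 1 :+ y) :+ con 1) ≡.refl x y ⟩
    suc x ℕ.* suc y ℕ.+ 1            ∎
    where
    open ℕₚ.≤-Reasoning
    open +-*-Solver

  -- Bounding `x + y` by `x * y + 1` leaves `(q - 1) * (x * y) ≤ 1`, a product of positive factors,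
  -- all of which must be 1.
  product≤sum : ∀ {q x y} → 1 < q → 0 < x → 0 < y → q ℕ.* (x ℕ.* y) ≤ x ℕ.+ y → q ≡ 2 × x ≡ 1 × y ≡ 1
  product≤sum {suc zero} (s≤s ())
  product≤sum {suc (suc k)} {suc x} {suc y} _ _ _ le = ≡.cong suc 1+k≡1 , x≡1 , y≡1
    where
    xy = suc x ℕ.* suc y
    le′ : xy ℕ.+ suc k ℕ.* xy ≤ xy ℕ.+ 1
    le′ = ℕₚ.≤-trans le (x+y≤xy+1 x y)
    eq : suc k ℕ.* xy ≡ 1
    eq = ℕₚ.≤-antisym (ℕₚ.+-cancelˡ-≤ xy _ _ le′) (s≤s z≤n)
    1+k≡1 : suc k ≡ 1
    1+k≡1 = ℕₚ.m*n≡1⇒m≡1 (suc k) xy eq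
    xy≡1 : xy ≡ 1
    xy≡1 = ℕₚ.m*n≡1⇒n≡1 (suc k) xy eq
    x≡1 : suc x ≡ 1
    x≡1 = ℕₚ.m*n≡1⇒m≡1 (suc x) (suc y) xy≡1
    y≡1 : suc y ≡ 1
    y≡1 = ℕₚ.m*n≡1⇒n≡1 (suc x) (suc y) xy≡1

  -- Cancelling one `q` from both sides gives the hypothesis of `product≤sum` for `q ^ r` and
  -- `q ^ s`. The exponents are successors because the cases with a zero exponent lead to the other
  -- two structures.
  power≤sum-of-powers : ∀ {q} r s → 1 < q → q ^ (suc r ℕ.+ suc s) ≤ q ^ suc r ℕ.+ q ^ suc s →
    q ≡ 2 × r ≡ 0 × s ≡ 0
  power≤sum-of-powers {q} r s 1<q le with product≤sum 1<q (0<q^ r) (0<q^ s)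
      (ℕₚ.*-cancelˡ-≤ q {{ℕ.>-nonZero 0<q}} (begin
        q ℕ.* (q ℕ.* (q ^ r ℕ.* q ^ s))   ≡⟨ solve 3 (λ q x y → q :* (q :* (x :* y)) := (q :* x) :*
            (q :* y)) ≡.refl q (q ^ r) (q ^ s) ⟩
        q ^ suc r ℕ.* q ^ suc s           ≡⟨ ℕₚ.^-distribˡ-+-* q (suc r) (suc s) ⟨
        q ^ (suc r ℕ.+ suc s)             ≤⟨ le ⟩
        q ^ suc r ℕ.+ q ^ suc s           ≡⟨ ℕₚ.*-distribˡ-+ q (q ^ r) (q ^ s) ⟨
        q ℕ.* (q ^ r ℕ.+ q ^ s)           ∎))
    where
    open ℕₚ.≤-Reasoning
    open +-*-Solver
    0<q : 0 < q
    0<q = ℕₚ.<-trans (s≤s z≤n) 1<q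
    0<q^ : ∀ n → 0 < q ^ n
    0<q^ n = ℕₚ.m^n>0 q {{ℕ.>-nonZero 0<q}} n
  ... | ≡.refl , qʳ≡1 , qˢ≡1 = ≡.refl , exponent r qʳ≡1 , exponent s qˢ≡1
    where
    exponent : ∀ n → 2 ^ n ≡ 1 → n ≡ 0
    exponent n e with ℕₚ.m^n≡1⇒n≡0∨m≡1 2 n e
    ... | inj₁ n≡0 = n≡0
    ... | inj₂ ()

-- Structure of primary extremal families

module ExtremalFamilies {q : ℕ} (D : MonicDomain q) where
  open MonicDomain D
  open CommutativeRing commutativeRing using
    (Carrier; _≈_; _*_; -_; _-_; 0#; 1#; refl; sym; trans; +-congˡ; +-assoc; -‿cong; *-congˡ; *-congʳ;
        *-comm; *-assoc;
     *-identityʳ; +-identityʳ; +-group)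
  open Divisibility commutativeRing
  open Irreducibles D
  open ExistenceOfIrreducibles D using (irreducible-exists)
  open Pigeonhole
  open ListLemmas
  open Arithmetic

  module _ {ℓ d : ℕ} (0<d : 0 < d) {F : List Carrier} (F-monic : All (Monic (ℓ ℕ.+ d)) F)
    (F-distinct : AllPairs (λ f g → ¬ f ≈ g) F) (F-size : length F ≡ q ^ d)
    (F-intersecting : ∀ {f g} → f ∈ F → g ∈ F → ∃₂ λ m c → Monic m c × ℓ ≤ m × c ∣ f × c ∣ g)
    (F-primary : ∀ {c} → All (c ∣_) F → c ∣ 1#) where

    -- Two outcomes are still coarse: `complementary` does not identify `H` as the least common
    -- multiple, and `exceptional` leaves `π` and `x` abstract. Both are sharpened later by another
    -- use of primarity.
    data Structure : Set where
      trivial : ∀ g → Monic ℓ g → All (g ∣_) F →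
        (∀ {f} → Monic (ℓ ℕ.+ d) f → g ∣ f → Any (f ≈_) F) → Structure
      complementary : ∀ H → All (λ f → ∃ λ p → Monic d p × f * p ≈ H) F →
        (∀ {p} → Monic d p → Any (λ f → f * p ≈ H) F) → Structure
      exceptional : ∀ {π x} → q ≡ 2 → d ≡ 2 → Irreducible 2 π → Monic (suc ℓ) x →
        All (λ f → ∃ λ y → Monic 1 y × (f * y ≈ π * x ⊎ x * y ≈ f)) F →
        (∀ {y} → Monic 1 y → y ∣ x) → Structure

    private
      π-irreducible = irreducible-exists 0<d
      π = proj₁ π-irreducible
      irr = proj₂ π-irreducible
      mπ = proj₁ irr

      π∣? : Decidable (π ∣_)
      π∣? = divides? mπ

    -- Members not divisible by π are distinct mod π, and q^d members cannot avoid the residue 0.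
    some-multiple : Any (π ∣_) F
    some-multiple with Any.any? π∣? F
    ... | yes found = found
    ... | no none = ⊥-elim (none (Any.map (λ (r , 0≈r , π∣f-r) → zero-residue⇒∣ 0≈r π∣f-r)
      (matching-surjective (λ f r → π ∣ f - r)
        (AllPairs.map disjoint (allPairs-zip (All.tabulate id) F-distinct))
        (All.universal (residues-complete mπ) F)
        (ℕₚ.≤-reflexive (≡.trans (length-residues d) (≡.sym F-size)))
        (zero-residue d)
        (λ f → map′ (λ π∣f → 0# , refl , ∣ʳ-respʳ-≈ (sym (x-0≈x f)) π∣f)
            (λ (r , 0≈r , π∣f-r) → zero-residue⇒∣ 0≈r π∣f-r)
                    (π∣? f)))))
      where
      open Algebra.Properties.Group +-group using (ε⁻¹≈ε; ⁻¹-anti-homo-//; \\-leftDividesʳ)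
      x-0≈x : ∀ x → x - 0# ≈ x
      x-0≈x x = trans (+-congˡ ε⁻¹≈ε) (+-identityʳ x)
      zero-residue⇒∣ : ∀ {f r} → 0# ≈ r → π ∣ f - r → π ∣ f
      zero-residue⇒∣ {f} 0≈r d = ∣ʳ-respʳ-≈ (trans (+-congˡ (-‿cong (sym 0≈r))) (x-0≈x f)) d
      difference : ∀ f g r → (f - r) - (g - r) ≈ f - g
      difference f g r = trans (+-congˡ (⁻¹-anti-homo-// g r)) (trans (+-assoc f (- r) (r - g))
        (+-congˡ (\\-leftDividesʳ r (- g))))
      disjoint : ∀ {f g} → f ∈ F × g ∈ F × ¬ f ≈ g → ∀ r → π ∣ f - r → ¬ π ∣ g - r
      disjoint {f} {g} (f∈ , g∈ , f≉g) r d₁ d₂ with F-intersecting f∈ g∈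
      ... | m , c , mc , ℓ≤m , c∣f , c∣g with irreducible⇒∣⊎coprime irr c
      ...   | inj₁ π∣c = none (Any.map (λ { ≡.refl → ∣ʳ-trans π∣c c∣f }) f∈)
      ...   | inj₂ coprime = f≉g (monic-diff (All.lookup F-monic f∈) (All.lookup F-monic g∈)
          (monic-* mπ mc) (≡.subst (_≤ d ℕ.+ m) (ℕₚ.+-comm d ℓ) (ℕₚ.+-monoʳ-≤ d ℓ≤m))
          (coprime-product coprime (∣ʳ-respʳ-≈ (difference f g r) (x∣y∧x∣z⇒x∣y-z d₁ d₂))
              (x∣y∧x∣z⇒x∣y-z c∣f c∣g)))

    some-nonmultiple : Any (λ f → ¬ π ∣ f) F
    some-nonmultiple with Any.any? (¬? ∘ π∣?) F
    ... | yes found = found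
    ... | no none   = ⊥-elim (ℕₚ.<⇒≱ 0<d (monic-∣⇒≤ mπ monic-one (F-primary
                        (All.tabulate λ {f} f∈ → decidable-stable (π∣? f)
                            (λ ∤f → none (Any.map (λ { ≡.refl → ∤f }) f∈))))))

    private
      F₁ = filter π∣? F
      F₀ = filter (¬? ∘ π∣?) F

    cofactor : ∀ {f} → f ∈ F → π ∣ f → ∃ λ m → Monic ℓ m × π * m ≈ f
    cofactor f∈ π∣f with monic-quotientʳ mπ (All.lookup F-monic f∈) π∣f
    ... | k , m , ℓ+d≡d+k , mm , πm≈f =
      m , ≡.subst (λ j → Monic j m) (ℕₚ.+-cancelˡ-≡ d k ℓ (≡.trans (≡.sym ℓ+d≡d+k) (ℕₚ.+-comm ℓ d))) mm , πm≈f

    -- A common divisor of πm and g is coprime to π, hence divides m, and it is no smaller than m.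
    cofactor-∣ : ∀ {f g m} → f ∈ F → g ∈ F → ¬ π ∣ g → Monic ℓ m → π * m ≈ f → m ∣ g
    cofactor-∣ f∈ g∈ π∤g mm πm≈f with F-intersecting f∈ g∈
    ... | k , c , mc , ℓ≤k , c∣f , c∣g with irreducible⇒∣⊎coprime irr c
    ...   | inj₁ π∣c     = ⊥-elim (π∤g (∣ʳ-trans π∣c c∣g))
    ...   | inj₂ coprime = ∣ʳ-respˡ-≈ (monic-∣⇒≈ mc mm ℓ≤k
              (coprime-divisor (coprime-sym coprime) (∣ʳ-respʳ-≈ (sym πm≈f) c∣f))) c∣g

    private
      module Gcd {t x} (mx : Monic t x) (x∣F₀ : All (x ∣_) F₀) (x-greatest : ∀ {c} → All (c ∣_) F₀ →
          c ∣ x) where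

        -- The cofactor `m` divides all of `F₀`, hence `x`, and `p` is the quotient x/m; so f·p =
        -- π·m·p = π·x.
        cofactor-∣-gcd : ∀ {f} → f ∈ F → π ∣ f → ∃₂ λ k p → t ≡ ℓ ℕ.+ k × Monic k p × f * p ≈ π * x
        cofactor-∣-gcd {f} f∈ π∣f =
          let m , mm , πm≈f = cofactor f∈ π∣f
              m∣x = x-greatest (All.tabulate λ g∈F₀ → let g∈ , π∤g = ∈-filter⁻ (¬? ∘ π∣?) {xs = F} g∈F₀ in
                      cofactor-∣ f∈ g∈ π∤g mm πm≈f)
              k , p , t≡ℓ+k , mp , mp≈x = monic-quotientʳ mm mx m∣x
          in k , p , t≡ℓ+k , mp , trans (*-congʳ (sym πm≈f)) (trans (*-assoc π m p) (*-congˡ mp≈x))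

        gcd-quotient : ∀ {g} → g ∈ F → ¬ π ∣ g → ∃₂ λ k y → ℓ ℕ.+ d ≡ t ℕ.+ k × Monic k y × x * y ≈ g
        gcd-quotient g∈ π∤g = monic-quotientʳ mx (All.lookup F-monic g∈)
          (All.lookup x∣F₀ (∈-filter⁺ (¬? ∘ π∣?) g∈ π∤g))

      module Split {r s x} (mx : Monic (ℓ ℕ.+ r) x) (d≡r+s : d ≡ r ℕ.+ s)
        (multiple : ∀ {f} → f ∈ F → π ∣ f → ∃ λ p → Monic r p × f * p ≈ π * x)
        (nonmultiple : ∀ {g} → g ∈ F → ¬ π ∣ g → ∃ λ y → Monic s y × x * y ≈ g) where

        Complement : ℕ → Carrier → Carrier → Set
        Complement k f p = Monic k p × f * p ≈ π * x

        complement-disjoint : ∀ {k} f g → ¬ f ≈ g → ∀ p → Complement k f p → ¬ Complement k g p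
        complement-disjoint f g f≉g p (mp , fp≈) (_ , gp≈) =
          f≉g (*-cancelˡ mp (trans (*-comm p f) (trans fp≈ (trans (sym gp≈) (*-comm g p)))))

        complement-listed : ∀ {k f p} → Monic k p → f * p ≈ π * x → Any (Complement k f) (monics k)
        complement-listed mp fp≈ =
            Any.map (λ p≈p′ → monic-resp p≈p′ mp , trans (*-congˡ (sym p≈p′)) fp≈) (monics-complete mp)

        complement? : ∀ {k p} → Monic k p → ∀ f → Dec (∃ λ p′ → p ≈ p′ × Complement k f p′)
        complement? {p = p} mp f = map′ (λ e → p , refl , mp , e)
          (λ (_ , p≈p′ , _ , e) → trans (*-congˡ p≈p′) e) (f * p ≟ π * x)

        multiple-disjoint : ∀ f g → ¬ f ≈ g → ∀ y → x * y ≈ f → ¬ x * y ≈ g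
        multiple-disjoint f g f≉g y e e′ = f≉g (trans (sym e) e′)

        multiple-listed : ∀ {k f y} → Monic k y → x * y ≈ f → Any (λ y → x * y ≈ f) (monics k)
        multiple-listed my e = Any.map (λ y≈y′ → trans (*-congˡ (sym y≈y′)) e) (monics-complete my)

        length-F₁≤ : length F₁ ≤ q ^ r
        length-F₁≤ = ≡.subst (length F₁ ≤_) (length-monics r) (matching⇒length≤ (Complement r)
          (AllPairs.map (complement-disjoint _ _) (AllPairsₚ.filter⁺ π∣? F-distinct))
          (All.tabulate λ f∈F₁ → let f∈ , π∣f = ∈-filter⁻ π∣? {xs = F} f∈F₁
                                     p , mp , e = multiple f∈ π∣f
                                 in complement-listed mp e))

        length-F₀≤ : length F₀ ≤ q ^ s
        length-F₀≤ = ≡.subst (length F₀ ≤_) (length-monics s) (matching⇒length≤ (λ g y → x * y ≈ g)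
          (AllPairs.map (multiple-disjoint _ _) (AllPairsₚ.filter⁺ (¬? ∘ π∣?) F-distinct))
          (All.tabulate λ g∈F₀ → let g∈ , π∤g = ∈-filter⁻ (¬? ∘ π∣?) {xs = F} g∈F₀
                                     y , my , e = nonmultiple g∈ π∤g
                                 in multiple-listed my e))

        F-size≤ : q ^ d ≤ q ^ r ℕ.+ q ^ s
        F-size≤ = ≡.subst (_≤ q ^ r ℕ.+ q ^ s) (≡.trans (≡.sym (length-filter-¬ π∣? F)) F-size)
          (ℕₚ.+-mono-≤ length-F₁≤ length-F₀≤)

        -- Each complement `p` is now 1, so a multiple of `π` in the family is `π * x`. All members
        -- are thus multiples of `x`, which has degree `ℓ`, and `q ^ d` distinct members exhaust the
        -- `q ^ d` monic multiples.
        structure-trivial : r ≡ 0 → Structure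
        structure-trivial ≡.refl = trivial x mx′
          (All.tabulate λ f∈ → let y , _ , e = all-multiples f∈ in y , trans (*-comm y x) e) present
          where
          mx′ : Monic ℓ x
          mx′ = ≡.subst (λ k → Monic k x) (ℕₚ.+-identityʳ ℓ) mx
          all-multiples : ∀ {f} → f ∈ F → ∃ λ y → Monic d y × x * y ≈ f
          all-multiples {f} f∈ with π∣? f
          ... | yes π∣f = let p , mp , e = multiple f∈ π∣f in
            π , mπ , trans (*-comm x π) (trans (sym e) (trans (*-congˡ (monic-zero mp)) (*-identityʳ f)))
          ... | no π∤f = let y , my , e = nonmultiple f∈ π∤f in
            y , ≡.subst (λ k → Monic k y) (≡.sym d≡r+s) my , e
          present : ∀ {f} → Monic (ℓ ℕ.+ d) f → x ∣ f → Any (f ≈_) F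
          present {f} mf x∣f with monic-quotientʳ mx′ mf x∣f
          ... | k , y , ℓ+d≡ℓ+k , my , xy≈f =
            Any.map (λ (y′ , y≈y′ , e) → trans (sym xy≈f) (trans (*-congˡ y≈y′) e))
              (matching-surjective (λ f y → x * y ≈ f) (AllPairs.map (multiple-disjoint _ _) F-distinct)
                (All.tabulate λ f∈ → let y , my , e = all-multiples f∈ in multiple-listed my e)
                (ℕₚ.≤-reflexive (≡.trans (length-monics d) (≡.sym F-size)))
                (monics-complete (≡.subst (λ k → Monic k y) (≡.sym (ℕₚ.+-cancelˡ-≡ ℓ d k ℓ+d≡ℓ+k)) my))
                (λ f → map′ (λ e → y , refl , e) (λ (y′ , y≈y′ , e) → trans (*-congˡ y≈y′) e) (x * y ≟ f)))

        -- A member not divisible by `π` is now `x` itself, that is, πx/π. So every member is πx/p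
        -- for a monic p of degree `d`, and the size of the family forces each p to occur.
        structure-complementary : s ≡ 0 → Structure
        structure-complementary ≡.refl = complementary (π * x) (All.tabulate all-complements) λ {p} mp →
          Any.map (λ (p′ , p≈p′ , _ , e) → trans (*-congˡ p≈p′) e)
            (matching-surjective (Complement d) (AllPairs.map (complement-disjoint _ _) F-distinct)
              (All.tabulate λ f∈ → let p , mp , e = all-complements f∈ in complement-listed mp e)
              (ℕₚ.≤-reflexive (≡.trans (length-monics d) (≡.sym F-size)))
              (monics-complete mp) (complement? mp))
          where
          all-complements : ∀ {f} → f ∈ F → ∃ λ p → Complement d f p
          all-complements {f} f∈ with π∣? f
          ... | yes π∣f = let p , mp , e = multiple f∈ π∣f in
            p , ≡.subst (λ k → Monic k p) (≡.trans (≡.sym (ℕₚ.+-identityʳ r)) (≡.sym d≡r+s)) mp , e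
          ... | no π∤f = let y , my , e = nonmultiple f∈ π∤f in
            π , mπ , trans (*-comm f π)
                (*-congˡ (trans (sym e) (trans (*-congˡ (monic-zero my)) (*-identityʳ x))))

        -- For `q = 2` the bound is attained, since q² = q + q. Hence `F₁` has its full size `q`,
        -- and its complements run through all linear monics.
        structure-exceptional : q ≡ 2 → r ≡ 1 → s ≡ 1 → Structure
        structure-exceptional q≡2 ≡.refl ≡.refl = exceptional q≡2 d≡r+s
            (≡.subst (λ k → Irreducible k π) d≡r+s irr)
          (≡.subst (λ k → Monic k x) (ℕₚ.+-comm ℓ 1) mx) (All.tabulate classify) linear-∣
          where
          classify : ∀ {f} → f ∈ F → ∃ λ y → Monic 1 y × (f * y ≈ π * x ⊎ x * y ≈ f)
          classify {f} f∈ with π∣? f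
          ... | yes π∣f = let p , mp , e = multiple f∈ π∣f in p , mp , inj₁ e
          ... | no π∤f  = let y , my , e = nonmultiple f∈ π∤f in y , my , inj₂ e
          2q≤F : q ^ 1 ℕ.+ q ^ 1 ≤ length F₁ ℕ.+ length F₀
          2q≤F = ≡.subst (q ^ 1 ℕ.+ q ^ 1 ≤_) (≡.trans (≡.sym (≡.trans F-size (≡.cong (q ^_) d≡r+s)))
              (length-filter-¬ π∣? F))
            (≡.subst (λ q → q ^ 1 ℕ.+ q ^ 1 ≤ q ^ 2) (≡.sym q≡2) ℕₚ.≤-refl)
          length-F₁≥ : q ^ 1 ≤ length F₁
          length-F₁≥ = ℕₚ.+-cancelʳ-≤ (q ^ 1) _ _ (ℕₚ.≤-trans 2q≤F (ℕₚ.+-monoʳ-≤ (length F₁) length-F₀≤))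
          -- Some member `f ≈ π * m` has complement `y`; cancelling `π` from π·m·y = π·x gives m·y =
          -- x.
          linear-∣ : ∀ {y} → Monic 1 y → y ∣ x
          linear-∣ {y} my with find (Any.map (λ (y′ , y≈y′ , _ , e) → trans (*-congˡ y≈y′) e)
              (matching-surjective (Complement 1)
                (AllPairs.map (complement-disjoint _ _) (AllPairsₚ.filter⁺ π∣? F-distinct))
                (All.tabulate λ f∈F₁ → let f∈ , π∣f = ∈-filter⁻ π∣? {xs = F} f∈F₁
                                           p , mp , e = multiple f∈ π∣f
                                       in complement-listed mp e)
                (≡.subst (_≤ length F₁) (≡.sym (length-monics 1)) length-F₁≥)
                (monics-complete my) (complement? my)))
          ... | f , f∈F₁ , fy≈πx with ∈-filter⁻ π∣? {xs = F} f∈F₁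
          ...   | f∈ , π∣f = let m , _ , πm≈f = cofactor f∈ π∣f in
            m , *-cancelˡ mπ (trans (sym (*-assoc π m y)) (trans (*-congʳ πm≈f) fy≈πx))

        structure : Structure
        structure with r ℕ.≟ 0 | s ℕ.≟ 0
        ... | yes r≡0 | _       = structure-trivial r≡0
        ... | no _    | yes s≡0 = structure-complementary s≡0
        ... | no r≢0  | no s≢0  with ℕₚ.m≤n⇒∃[o]m+o≡n (ℕₚ.n≢0⇒n>0 r≢0) | ℕₚ.m≤n⇒∃[o]m+o≡n (ℕₚ.n≢0⇒n>0 s≢0)
        ...   | r′ , ≡.refl | s′ , ≡.refl with power≤sum-of-powers r′ s′ 1<q
                  (≡.subst (λ k → q ^ k ≤ q ^ r ℕ.+ q ^ s) d≡r+s F-size≤)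
        ...     | q≡2 , ≡.refl , ≡.refl = structure-exceptional q≡2 ≡.refl ≡.refl

    structure : Structure
    structure with find some-multiple | find some-nonmultiple
    ... | f , f∈ , π∣f | g , g∈ , π∤g
      with gcd-list (Allₚ.filter⁺ (¬? ∘ π∣?) F-monic) (∈⇒0<length (∈-filter⁺ (¬? ∘ π∣?) g∈ π∤g))
    ...   | t , x , mx , x∣F₀ , x-greatest = go (Gcd.cofactor-∣-gcd mx x∣F₀ x-greatest f∈ π∣f)
        (Gcd.gcd-quotient mx x∣F₀ x-greatest g∈ π∤g)
      where
      open Gcd mx x∣F₀ x-greatest
      go : (∃₂ λ k p → t ≡ ℓ ℕ.+ k × Monic k p × f * p ≈ π * x) →
           (∃₂ λ k y → ℓ ℕ.+ d ≡ t ℕ.+ k × Monic k y × x * y ≈ g) → Structure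
      -- One multiple and one nonmultiple of `π` give `ℓ ≤ t ≤ ℓ + d` and define `r` and `s`. The
      -- other members share these degrees, because `t` and `ℓ + d` determine them.
      go (r , _ , t≡ℓ+r , _) (s , _ , ℓ+d≡t+s , _) = Split.structure {r} {s}
        (≡.subst (λ k → Monic k x) t≡ℓ+r mx)
        (ℕₚ.+-cancelˡ-≡ ℓ d (r ℕ.+ s) (≡.trans ℓ+d≡t+s (≡.trans (≡.cong (ℕ._+ s) t≡ℓ+r) (ℕₚ.+-assoc ℓ r s))))
        (λ f∈ π∣f → let k , p , t≡ℓ+k , mp , e = cofactor-∣-gcd f∈ π∣f in
          p , ≡.subst (λ j → Monic j p) (ℕₚ.+-cancelˡ-≡ ℓ k r (≡.trans (≡.sym t≡ℓ+k) t≡ℓ+r)) mp , e)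
        (λ g∈ π∤g → let k , y , ℓ+d≡t+k , my , e = gcd-quotient g∈ π∤g in
          y , ≡.subst (λ j → Monic j y) (ℕₚ.+-cancelˡ-≡ t k s (≡.trans (≡.sym ℓ+d≡t+k) ℓ+d≡t+s)) my , e)

-- The exceptional case with exactly two linear monics

module ProductsOfTwoLinear {q : ℕ} (D : MonicDomain q) where
  open MonicDomain D
  open CommutativeRing commutativeRing using
    (Carrier; _≈_; _*_; 1#; refl; sym; trans; *-cong; *-congˡ; *-comm; *-assoc; *-identityʳ;
        commutativeSemiring)
  open Divisibility commutativeRing
  open Irreducibles D
  open Algebra.Solver.Ring.NaturalCoefficients.Default commutativeSemiring using (solve; _:=_; _:*_)

  -- `a` and `b` become `X` and `X+1`. Both divide `x`, so x = a·b·h, and everything hinges on h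
  -- being 1.
  module TwoLinear {ℓ : ℕ} {a b π x : Carrier} {F : List Carrier} (ma : Monic 1 a) (mb : Monic 1 b)
    (coprime : Coprime a b) (linear : ∀ {y} → Monic 1 y → y ≈ a ⊎ y ≈ b) (mx : Monic (suc ℓ) x)
    (linear∣x : ∀ {y} → Monic 1 y → y ∣ x)
    (members : All (λ f → ∃ λ y → Monic 1 y × (f * y ≈ π * x ⊎ x * y ≈ f)) F)
    (F-primary : ∀ {c} → All (c ∣_) F → c ∣ 1#) where

    private
      quotient : ∃₂ λ k h → suc ℓ ≡ 2 ℕ.+ k × Monic k h × a * b * h ≈ x
      quotient = monic-quotientʳ (monic-* ma mb) mx (coprime-product coprime (linear∣x ma) (linear∣x mb))

      h : Carrier
      h = proj₁ (proj₂ quotient)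

      abh≈x : a * b * h ≈ x
      abh≈x = proj₂ (proj₂ (proj₂ (proj₂ quotient)))

      lemma₁ : ∀ π a b h → π * (a * b * h) ≈ a * (π * b * h)
      lemma₁ = solve 4 (λ π a b h → (π :* (a :* b :* h)) := (a :* (π :* b :* h))) refl

      lemma₂ : ∀ π a b h → π * (a * b * h) ≈ b * (π * a * h)
      lemma₂ = solve 4 (λ π a b h → (π :* (a :* b :* h)) := (b :* (π :* a :* h))) refl

      lemma₃ : ∀ π a b → π * (a * b) ≈ a * (b * π)
      lemma₃ = solve 3 (λ π a b → (π :* (a :* b)) := (a :* (b :* π))) refl

      lemma₄ : ∀ π a b → π * (a * b) ≈ b * (a * π)
      lemma₄ = solve 3 (λ π a b → (π :* (a :* b)) := (b :* (a :* π))) refl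

      lemma₅ : ∀ a b → a * b * a ≈ a * a * b
      lemma₅ = solve 2 (λ a b → (a :* b :* a) := (a :* a :* b)) refl

      factor : ∀ {f y g c} → Monic 1 c → y ≈ c → f * y ≈ π * x → π * x ≈ c * g → f ≈ g
      factor {f} mc y≈c fy≈πx πx≈cg =
        *-cancelˡ mc (trans (*-comm _ f) (trans (*-congˡ (sym y≈c)) (trans fy≈πx πx≈cg)))

      -- For a member πx/y the only candidates are `y ≈ a` and `y ≈ b`, which leave `π * b * h` and
      -- `π * a * h`. Primarity then makes `h` trivial.
      h∣member : ∀ {f} → (∃ λ y → Monic 1 y × (f * y ≈ π * x ⊎ x * y ≈ f)) → h ∣ f
      h∣member (y , my , inj₂ xy≈f) = ∣ʳ-respʳ-≈ xy≈f (x∣y⇒x∣yz y (a * b , abh≈x))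
      h∣member (y , my , inj₁ fy≈πx) with linear my
      ... | inj₁ y≈a = π * b , sym (factor ma y≈a fy≈πx (trans (*-congˡ (sym abh≈x)) (lemma₁ π a b h)))
      ... | inj₂ y≈b = π * a , sym (factor mb y≈b fy≈πx (trans (*-congˡ (sym abh≈x)) (lemma₂ π a b h)))

      h≈1 : h ≈ 1#
      h≈1 = monic-∣⇒≈ (proj₁ (proj₂ (proj₂ (proj₂ quotient)))) monic-one z≤n
          (F-primary (All.map h∣member members))

      x≈ab : x ≈ a * b
      x≈ab = trans (sym abh≈x) (trans (*-congˡ h≈1) (*-identityʳ _))

    -- The four entries are xa, xb, πx/b and πx/a with x = ab; the degree of `x` is both `suc ℓ` and
    -- 2.
    members-listed : ℓ ≡ 1 × All (λ f → Any (f ≈_) (a * a * b ∷ a * (b * b) ∷ a * π ∷ b * π ∷ [])) F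
    members-listed = ℕₚ.suc-injective (monic-unique mx (monic-resp (sym x≈ab) (monic-* ma mb))) ,
        All.map listed members
      where
      listed : ∀ {f} → (∃ λ y → Monic 1 y × (f * y ≈ π * x ⊎ x * y ≈ f)) →
        Any (f ≈_) (a * a * b ∷ a * (b * b) ∷ a * π ∷ b * π ∷ [])
      listed (y , my , e) with linear my
      listed (y , my , inj₂ xy≈f) | inj₁ y≈a = here (trans (sym xy≈f) (trans (*-cong x≈ab y≈a) (lemma₅ a b)))
      listed (y , my , inj₂ xy≈f) | inj₂ y≈b =
          there (here (trans (sym xy≈f) (trans (*-cong x≈ab y≈b) (*-assoc a b b))))
      listed (y , my , inj₁ fy≈πx) | inj₁ y≈a =
        there (there (there (here (factor ma y≈a fy≈πx (trans (*-congˡ x≈ab) (lemma₃ π a b))))))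
      listed (y , my , inj₁ fy≈πx) | inj₂ y≈b =
        there (there (here (factor mb y≈b fy≈πx (trans (*-congˡ x≈ab) (lemma₄ π a b)))))

-- The commutative ring of coefficient lists

module PolynomialRing {q : ℕ} (K : FiniteField q) where
  open FiniteField K
  open Poly K

  fieldRing : CommutativeRing 0ℓ 0ℓ
  fieldRing = record { isCommutativeRing = isCommutativeRing }

  private
    module F = CommutativeRing fieldRing
    module FP = Algebra.Properties.Ring F.ring
    open ≡.≡-Reasoning

  infix 4 _≈_
  -- A record, so that p and r can be inferred from a proof of p ≈ r.
  record _≈_ (p r : Pol) : Set where
    constructor ⟨_⟩
    field at : p ≈ₚ r
  open _≈_ public

  ≈-refl : ∀ {p} → p ≈ p
  ≈-refl = ⟨ (λ _ → ≡.refl) ⟩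

  ≈-sym : ∀ {p r} → p ≈ r → r ≈ p
  ≈-sym e = ⟨ (λ i → ≡.sym (at e i)) ⟩

  ≈-trans : ∀ {p r s} → p ≈ r → r ≈ s → p ≈ s
  ≈-trans e e′ = ⟨ (λ i → ≡.trans (at e i) (at e′ i)) ⟩

  ∷-cong : ∀ {a b p r} → a ≡ b → p ≈ r → (a ∷ p) ≈ (b ∷ r)
  ∷-cong a≡b e = ⟨ (λ { zero → a≡b ; (suc i) → at e i }) ⟩

  ∷-zero : ∀ {p} → p ≈ [] → (0# ∷ p) ≈ []
  ∷-zero e = ⟨ (λ { zero → ≡.refl ; (suc i) → at e i }) ⟩

  coeff-addP : ∀ p r i → coeff (addP p r) i ≡ coeff p i + coeff r i
  coeff-addP []      r       i       = ≡.sym (F.+-identityˡ _)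
  coeff-addP (a ∷ p) []      i       = ≡.sym (F.+-identityʳ _)
  coeff-addP (a ∷ p) (b ∷ r) zero    = ≡.refl
  coeff-addP (a ∷ p) (b ∷ r) (suc i) = coeff-addP p r i

  coeff-scale : ∀ a p i → coeff (scale a p) i ≡ a * coeff p i
  coeff-scale a []      i       = ≡.sym (F.zeroʳ a)
  coeff-scale a (b ∷ p) zero    = ≡.refl
  coeff-scale a (b ∷ p) (suc i) = coeff-scale a p i

  addP-cong : ∀ {p p′ r r′} → p ≈ p′ → r ≈ r′ → addP p r ≈ addP p′ r′
  addP-cong {p} {p′} {r} {r′} e e′ = ⟨ (λ i → begin
    coeff (addP p r) i        ≡⟨ coeff-addP p r i ⟩
    coeff p i + coeff r i     ≡⟨ ≡.cong₂ _+_ (at e i) (at e′ i) ⟩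
    coeff p′ i + coeff r′ i   ≡⟨ coeff-addP p′ r′ i ⟨
    coeff (addP p′ r′) i      ∎) ⟩

  addP-congˡ : ∀ p {r r′} → r ≈ r′ → addP p r ≈ addP p r′
  addP-congˡ p = addP-cong (≈-refl {p})

  addP-assoc : ∀ p r s → addP (addP p r) s ≈ addP p (addP r s)
  addP-assoc p r s = ⟨ (λ i → begin
    coeff (addP (addP p r) s) i             ≡⟨ coeff-addP (addP p r) s i ⟩
    coeff (addP p r) i + coeff s i          ≡⟨ ≡.cong (_+ coeff s i) (coeff-addP p r i) ⟩
    coeff p i + coeff r i + coeff s i       ≡⟨ F.+-assoc _ _ _ ⟩
    coeff p i + (coeff r i + coeff s i)     ≡⟨ ≡.cong (coeff p i +_) (coeff-addP r s i) ⟨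
    coeff p i + coeff (addP r s) i          ≡⟨ coeff-addP p (addP r s) i ⟨
    coeff (addP p (addP r s)) i             ∎) ⟩

  addP-comm : ∀ p r → addP p r ≈ addP r p
  addP-comm p r = ⟨ (λ i → begin
    coeff (addP p r) i      ≡⟨ coeff-addP p r i ⟩
    coeff p i + coeff r i   ≡⟨ F.+-comm _ _ ⟩
    coeff r i + coeff p i   ≡⟨ coeff-addP r p i ⟨
    coeff (addP r p) i      ∎) ⟩

  addP-identityʳ : ∀ p → addP p [] ≈ p
  addP-identityʳ []      = ≈-refl
  addP-identityʳ (a ∷ p) = ≈-refl

  negP : Pol → Pol
  negP = scale (- 1#)

  scale-cong : ∀ {a b p r} → a ≡ b → p ≈ r → scale a p ≈ scale b r
  scale-cong {a} {b} {p} {r} a≡b e = ⟨ (λ i → begin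
    coeff (scale a p) i   ≡⟨ coeff-scale a p i ⟩
    a * coeff p i         ≡⟨ ≡.cong₂ _*_ a≡b (at e i) ⟩
    b * coeff r i         ≡⟨ coeff-scale b r i ⟨
    coeff (scale b r) i   ∎) ⟩

  addP-inverseʳ : ∀ p → addP p (negP p) ≈ []
  addP-inverseʳ p = ⟨ (λ i → begin
    coeff (addP p (negP p)) i          ≡⟨ coeff-addP p (negP p) i ⟩
    coeff p i + coeff (negP p) i       ≡⟨ ≡.cong (coeff p i +_) (coeff-scale (- 1#) p i) ⟩
    coeff p i + (- 1#) * coeff p i     ≡⟨ ≡.cong (coeff p i +_) (FP.-1*x≈-x (coeff p i)) ⟩
    coeff p i + - coeff p i            ≡⟨ F.-‿inverseʳ _ ⟩
    0#                                 ∎) ⟩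

  scale-distribˡ-addP : ∀ a p r → scale a (addP p r) ≈ addP (scale a p) (scale a r)
  scale-distribˡ-addP a p r = ⟨ (λ i → begin
    coeff (scale a (addP p r)) i                  ≡⟨ coeff-scale a (addP p r) i ⟩
    a * coeff (addP p r) i                        ≡⟨ ≡.cong (a *_) (coeff-addP p r i) ⟩
    a * (coeff p i + coeff r i)                   ≡⟨ F.distribˡ _ _ _ ⟩
    a * coeff p i + a * coeff r i                 ≡⟨ ≡.cong₂ _+_ (coeff-scale a p i) (coeff-scale a r i) ⟨
    coeff (scale a p) i + coeff (scale a r) i     ≡⟨ coeff-addP (scale a p) (scale a r) i ⟨
    coeff (addP (scale a p) (scale a r)) i        ∎) ⟩

  scale-distribʳ-+ : ∀ a b p → scale (a + b) p ≈ addP (scale a p) (scale b p)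
  scale-distribʳ-+ a b p = ⟨ (λ i → begin
    coeff (scale (a + b) p) i                     ≡⟨ coeff-scale (a + b) p i ⟩
    (a + b) * coeff p i                           ≡⟨ F.distribʳ _ _ _ ⟩
    a * coeff p i + b * coeff p i                 ≡⟨ ≡.cong₂ _+_ (coeff-scale a p i) (coeff-scale b p i) ⟨
    coeff (scale a p) i + coeff (scale b p) i     ≡⟨ coeff-addP (scale a p) (scale b p) i ⟨
    coeff (addP (scale a p) (scale b p)) i        ∎) ⟩

  scale-assoc : ∀ a b p → scale (a * b) p ≈ scale a (scale b p)
  scale-assoc a b p = ⟨ (λ i → begin
    coeff (scale (a * b) p) i         ≡⟨ coeff-scale (a * b) p i ⟩
    a * b * coeff p i                 ≡⟨ F.*-assoc _ _ _ ⟩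
    a * (b * coeff p i)               ≡⟨ ≡.cong (a *_) (coeff-scale b p i) ⟨
    a * coeff (scale b p) i           ≡⟨ coeff-scale a (scale b p) i ⟨
    coeff (scale a (scale b p)) i     ∎) ⟩

  scale-identity : ∀ p → scale 1# p ≈ p
  scale-identity p = ⟨ (λ i → ≡.trans (coeff-scale 1# p i) (F.*-identityˡ _)) ⟩

  scale-zero : ∀ p → scale 0# p ≈ []
  scale-zero p = ⟨ (λ i → ≡.trans (coeff-scale 0# p i) (F.zeroˡ _)) ⟩

  +-abelianGroup : AbelianGroup 0ℓ 0ℓ
  +-abelianGroup = record { isAbelianGroup = record
    { isGroup = record
      { isMonoid = record
        { isSemigroup = record
          { isMagma = record
            { isEquivalence = record { refl = ≈-refl ; sym = ≈-sym ; trans = ≈-trans }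
            ; ∙-cong = addP-cong }
          ; assoc = addP-assoc }
        ; identity = (λ _ → ≈-refl) , addP-identityʳ }
      ; inverse = (λ p → ≈-trans (addP-comm (negP p) p) (addP-inverseʳ p)) , addP-inverseʳ
      ; ⁻¹-cong = scale-cong ≡.refl }
    ; comm = addP-comm } }

  private
    module A = AbelianGroup +-abelianGroup
    module AC = Algebra.Properties.CommutativeSemigroup A.commutativeSemigroup
    open Relation.Binary.Reasoning.Setoid A.setoid renaming (begin_ to begin′_; _∎ to _∎′)
      using (step-≈-⟩; step-≈-⟨)

  mulP-congˡ : ∀ p {r r′} → r ≈ r′ → mulP p r ≈ mulP p r′
  mulP-congˡ []      e = ≈-refl
  mulP-congˡ (a ∷ p) e = addP-cong (scale-cong ≡.refl e) (∷-cong ≡.refl (mulP-congˡ p e))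

  mulP-zeroʳ : ∀ p → mulP p [] ≈ []
  mulP-zeroʳ []      = ≈-refl
  mulP-zeroʳ (a ∷ p) = ∷-zero (mulP-zeroʳ p)

  addP-shift : ∀ p r → (0# ∷ addP p r) ≈ addP (0# ∷ p) (0# ∷ r)
  addP-shift p r = ∷-cong (≡.sym (F.+-identityʳ 0#)) ≈-refl

  -- `mulP` recurses on its left factor; this expansion along the right factor is the inductive step
  -- of commutativity.
  mulP-∷ʳ : ∀ p b r → mulP p (b ∷ r) ≈ addP (scale b p) (0# ∷ mulP p r)
  mulP-∷ʳ []      b r = ≈-sym (∷-zero ≈-refl)
  mulP-∷ʳ (a ∷ p) b r = ∷-cong (≡.cong (_+ 0#) (F.*-comm a b)) (begin′
    addP (scale a r) (mulP p (b ∷ r))                      ≈⟨ addP-congˡ (scale a r) (mulP-∷ʳ p b r) ⟩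
    addP (scale a r) (addP (scale b p) (0# ∷ mulP p r))    ≈⟨ AC.x∙yz≈y∙xz (scale a r) (scale b p)
        (0# ∷ mulP p r) ⟩
    addP (scale b p) (addP (scale a r) (0# ∷ mulP p r))    ∎′)

  mulP-comm : ∀ p r → mulP p r ≈ mulP r p
  mulP-comm []      r = ≈-sym (mulP-zeroʳ r)
  mulP-comm (a ∷ p) r = begin′
    addP (scale a r) (0# ∷ mulP p r)   ≈⟨ addP-congˡ (scale a r) (∷-cong ≡.refl (mulP-comm p r)) ⟩
    addP (scale a r) (0# ∷ mulP r p)   ≈⟨ mulP-∷ʳ r a p ⟨
    mulP r (a ∷ p)                     ∎′

  -- Equal polynomials can be lists of different lengths, which obstructs recursion on the left
  -- factor. Commutativity moves the change to the right, where `mulP-congˡ` applies.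
  mulP-congʳ : ∀ {p p′} r → p ≈ p′ → mulP p r ≈ mulP p′ r
  mulP-congʳ {p} {p′} r e =
    ≈-trans (mulP-comm p r) (≈-trans (mulP-congˡ r e) (mulP-comm r p′))

  mulP-cong : ∀ {p p′ r r′} → p ≈ p′ → r ≈ r′ → mulP p r ≈ mulP p′ r′
  mulP-cong {p} {r′ = r′} e e′ = ≈-trans (mulP-congˡ p e′) (mulP-congʳ r′ e)

  mulP-distribʳ : ∀ s p r → mulP (addP p r) s ≈ addP (mulP p s) (mulP r s)
  mulP-distribʳ s []      r       = ≈-refl
  mulP-distribʳ s (a ∷ p) []      = ≈-sym (addP-identityʳ _)
  mulP-distribʳ s (a ∷ p) (b ∷ r) = begin′
    addP (scale (a + b) s) (0# ∷ mulP (addP p r) s)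
      ≈⟨ addP-cong (scale-distribʳ-+ a b s) (∷-cong ≡.refl (mulP-distribʳ s p r)) ⟩
    addP (addP (scale a s) (scale b s)) (0# ∷ addP (mulP p s) (mulP r s))
      ≈⟨ addP-congˡ (addP (scale a s) (scale b s)) (addP-shift (mulP p s) (mulP r s)) ⟩
    addP (addP (scale a s) (scale b s)) (addP (0# ∷ mulP p s) (0# ∷ mulP r s))
      ≈⟨ AC.interchange (scale a s) (scale b s) (0# ∷ mulP p s) (0# ∷ mulP r s) ⟩
    addP (addP (scale a s) (0# ∷ mulP p s)) (addP (scale b s) (0# ∷ mulP r s)) ∎′

  mulP-scaleˡ : ∀ a p r → mulP (scale a p) r ≈ scale a (mulP p r)
  mulP-scaleˡ a []      r = ≈-refl
  mulP-scaleˡ a (b ∷ p) r = begin′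
    addP (scale (a * b) r) (0# ∷ mulP (scale a p) r)
      ≈⟨ addP-cong (scale-assoc a b r) (∷-cong (≡.sym (F.zeroʳ a)) (mulP-scaleˡ a p r)) ⟩
    addP (scale a (scale b r)) (scale a (0# ∷ mulP p r))
      ≈⟨ scale-distribˡ-addP a (scale b r) (0# ∷ mulP p r) ⟨
    scale a (addP (scale b r) (0# ∷ mulP p r)) ∎′

  mulP-shiftˡ : ∀ p r → mulP (0# ∷ p) r ≈ (0# ∷ mulP p r)
  mulP-shiftˡ p r = addP-cong (scale-zero r) (≈-refl {0# ∷ mulP p r})

  mulP-assoc : ∀ p r s → mulP (mulP p r) s ≈ mulP p (mulP r s)
  mulP-assoc []      r s = ≈-refl
  mulP-assoc (a ∷ p) r s = begin′
    mulP (addP (scale a r) (0# ∷ mulP p r)) s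
      ≈⟨ mulP-distribʳ s (scale a r) (0# ∷ mulP p r) ⟩
    addP (mulP (scale a r) s) (mulP (0# ∷ mulP p r) s)
      ≈⟨ addP-cong (mulP-scaleˡ a r s) (mulP-shiftˡ (mulP p r) s) ⟩
    addP (scale a (mulP r s)) (0# ∷ mulP (mulP p r) s)
      ≈⟨ addP-congˡ (scale a (mulP r s)) (∷-cong ≡.refl (mulP-assoc p r s)) ⟩
    addP (scale a (mulP r s)) (0# ∷ mulP p (mulP r s)) ∎′

  mulP-identityˡ : ∀ p → mulP oneP p ≈ p
  mulP-identityˡ p = begin′
    addP (scale 1# p) (0# ∷ [])   ≈⟨ addP-cong (scale-identity p) (∷-zero ≈-refl) ⟩
    addP p []                     ≈⟨ addP-identityʳ p ⟩
    p                             ∎′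

  polynomialRing : CommutativeRing 0ℓ 0ℓ
  polynomialRing = record
    { Carrier = Pol ; _≈_ = _≈_ ; _+_ = addP ; _*_ = mulP ; -_ = negP ; 0# = [] ; 1# = oneP
    ; isCommutativeRing = record
      { isRing = record
        { +-isAbelianGroup = A.isAbelianGroup
        ; *-cong = mulP-cong
        ; *-assoc = mulP-assoc
        ; *-identity = mulP-identityˡ , λ p → ≈-trans (mulP-comm p oneP) (mulP-identityˡ p)
        ; distrib = (λ s p r → ≈-trans (mulP-comm s (addP p r)) (≈-trans (mulP-distribʳ s p r)
                                 (addP-cong (mulP-comm p s) (mulP-comm r s))))
                  , mulP-distribʳ }
      ; *-comm = mulP-comm } }

-- Degrees, division with remainder and enumeration of polynomials

module PolynomialDomain {q : ℕ} (K : FiniteField q) where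
  open FiniteField K
  open Poly K
  open PolynomialRing K
  open Divisibility polynomialRing
  private
    module F = CommutativeRing fieldRing
    module P = CommutativeRing polynomialRing

  infix 4 _≟ꟳ_ _≟ₚ_
  _≟ꟳ_ : DecidableEquality Carrier
  _≟ꟳ_ = via-injection (↔⇒↣ card) Fin._≟_

  zero? : ∀ p → Dec (p ≈ [])
  zero? []      = yes ≈-refl
  zero? (a ∷ p) with a ≟ꟳ 0# | zero? p
  ... | yes ≡.refl | yes p≈0 = yes (∷-zero p≈0)
  ... | no a≢0     | _       = no λ e → a≢0 (at e 0)
  ... | _          | no p≉0  = no λ e → p≉0 ⟨ (λ i → at e (suc i)) ⟩

  p-r≈0⇒p≈r : ∀ {p r} → addP p (negP r) ≈ [] → p ≈ r
  p-r≈0⇒p≈r = Algebra.Properties.Group.x∙y⁻¹≈ε⇒x≈y P.+-group _ _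

  _≟ₚ_ : ∀ p r → Dec (p ≈ r)
  p ≟ₚ r = map′ p-r≈0⇒p≈r
    (λ p≈r → P.trans (addP-cong p≈r (≈-refl {negP r})) (addP-inverseʳ r)) (zero? (addP p (negP r)))

  HasDegree≤ : Pol → ℕ → Set
  HasDegree≤ p n = ∀ i → n < i → coeff p i ≡ 0#

  -- Recursion on the bound `m`: at 0 the product is a scalar multiple of `r`; at `suc m` the
  -- summand `scale a r` vanishes above degree `n`, which leaves the shifted product of the tail.
  mulP-top : ∀ {p r m n} → HasDegree≤ p m → HasDegree≤ r n →
    HasDegree≤ (mulP p r) (m ℕ.+ n) × coeff (mulP p r) (m ℕ.+ n) ≡ coeff p m * coeff r n
  mulP-top {[]}    p≤ r≤ = (λ _ _ → ≡.refl) , ≡.sym (F.zeroˡ _)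
  mulP-top {a ∷ p} {r} {zero} {n} p≤ r≤ =
    (λ i n<i → ≡.trans (at pr≈ar i)
        (≡.trans (coeff-scale a r i) (≡.trans (≡.cong (a *_) (r≤ i n<i)) (F.zeroʳ a)))) ,
    ≡.trans (at pr≈ar n) (coeff-scale a r n)
    where
    p≈0 : p ≈ []
    p≈0 = ⟨ (λ i → p≤ (suc i) (s≤s z≤n)) ⟩
    pr≈ar : mulP (a ∷ p) r ≈ scale a r
    pr≈ar = P.trans (addP-congˡ (scale a r) (∷-zero (mulP-congʳ r p≈0))) (addP-identityʳ (scale a r))
  mulP-top {a ∷ p} {r} {suc m} {n} p≤ r≤ with mulP-top {p} {r} {m} {n} (λ i m<i → p≤ (suc i) (s≤s m<i)) r≤
  ... | pr≤ , top =
    (λ { (suc i) (s≤s m+n<i) →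
        ≡.trans (coefficient i (ℕₚ.<-trans (ℕₚ.≤-<-trans (ℕₚ.m≤n+m n m) m+n<i) ℕₚ.≤-refl))
                                 (pr≤ i m+n<i) }) ,
    ≡.trans (coefficient (m ℕ.+ n) (s≤s (ℕₚ.m≤n+m n m))) top
    where
    coefficient : ∀ i → n < suc i → coeff (mulP (a ∷ p) r) (suc i) ≡ coeff (mulP p r) i
    coefficient i n<i = begin
      coeff (addP (scale a r) (0# ∷ mulP p r)) (suc i)   ≡⟨ coeff-addP (scale a r) (0# ∷ mulP p r) (suc i) ⟩
      coeff (scale a r) (suc i) + coeff (mulP p r) i     ≡⟨ ≡.cong (_+ coeff (mulP p r) i)
          (coeff-scale a r (suc i)) ⟩
      a * coeff r (suc i) + coeff (mulP p r) i           ≡⟨ ≡.cong (λ c → a * c + coeff (mulP p r) i)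
          (r≤ (suc i) n<i) ⟩
      a * 0# + coeff (mulP p r) i                        ≡⟨ ≡.cong (_+ coeff (mulP p r) i) (F.zeroʳ a) ⟩
      0# + coeff (mulP p r) i                            ≡⟨ F.+-identityˡ _ ⟩
      coeff (mulP p r) i                                 ∎
      where open ≡.≡-Reasoning

  monic-resp : ∀ {n p r} → p ≈ r → Monic p n → Monic r n
  monic-resp {n} e (lead , p≤) = ≡.trans (≡.sym (at e n)) lead , λ i n<i → ≡.trans (≡.sym (at e i)) (p≤ i n<i)

  monic-one : Monic oneP 0
  monic-one = ≡.refl , λ { (suc i) _ → ≡.refl }

  monic-zero : ∀ {p} → Monic p 0 → p ≈ oneP
  monic-zero (lead , p≤) = ⟨ (λ { zero → lead ; (suc i) → p≤ (suc i) (s≤s z≤n) }) ⟩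

  monic-* : ∀ {m n} p r → Monic p m → Monic r n → Monic (mulP p r) (m ℕ.+ n)
  monic-* {m} {n} p r (pm , p≤) (rn , r≤) with mulP-top {p} {r} {m} {n} p≤ r≤
  ... | pr≤ , top = ≡.trans top (≡.trans (≡.cong₂ _*_ pm rn) (F.*-identityˡ 1#)) , pr≤

  Associated : Pol → Set
  Associated p = ∃₂ λ n r → ∃ λ c → c ≢ 0# × Monic r n × p ≈ scale c r

  zero⊎associated : ∀ p → p ≈ [] ⊎ Associated p
  zero⊎associated [] = inj₁ ≈-refl
  zero⊎associated (a ∷ p) with zero⊎associated p
  ... | inj₂ (n , r , c , c≢0 , (lead , r≤) , p≈cr) with inverse c c≢0
  ...   | c⁻¹ , cc⁻¹≡1 = inj₂ (suc n , (c⁻¹ * a) ∷ r , c , c≢0 ,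
      (lead , λ { (suc i) (s≤s n<i) → r≤ i n<i }) ,
      ∷-cong (≡.trans (≡.sym (F.*-identityˡ a)) (≡.trans (≡.cong (_* a) (≡.sym cc⁻¹≡1))
          (F.*-assoc c c⁻¹ a))) p≈cr)
  zero⊎associated (a ∷ p) | inj₁ p≈0 with a ≟ꟳ 0#
  ... | yes ≡.refl = inj₁ (∷-zero p≈0)
  ... | no a≢0     = inj₂ (0 , oneP , a , a≢0 , monic-one , ∷-cong (≡.sym (F.*-identityʳ a)) p≈0)

  monic-scale-lead : ∀ {n} p c → Monic p n → coeff (scale c p) n ≡ c
  monic-scale-lead {n} p c (lead , _) =
    ≡.trans (coeff-scale c p n) (≡.trans (≡.cong (c *_) lead) (F.*-identityʳ c))

  monic-scale-unique : ∀ {m n p r c} → c ≢ 0# → Monic p m → Monic r n → p ≈ scale c r → m ≡ n × p ≈ r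
  monic-scale-unique {m} {n} {p} {r} {c} c≢0 mp@(lead , p≤) mr@(_ , r≤) p≈cr with ℕₚ.<-cmp m n
  ... | tri< m<n _ _ = ⊥-elim
      (c≢0 (≡.trans (≡.sym (monic-scale-lead r c mr)) (≡.trans (≡.sym (at p≈cr n)) (p≤ n m<n))))
  ... | tri> _ _ n<m = ⊥-elim (0≢1 (≡.sym (≡.trans (≡.sym lead) (≡.trans (at p≈cr m)
                         (≡.trans (coeff-scale c r m) (≡.trans (≡.cong (c *_) (r≤ m n<m)) (F.zeroʳ c)))))))
  ... | tri≈ _ ≡.refl _ with ≡.trans (≡.sym lead) (≡.trans (at p≈cr m) (monic-scale-lead r c mr))
  ...   | ≡.refl = ≡.refl , P.trans p≈cr (scale-identity r)

  monic-unique : ∀ {m n p} → Monic p m → Monic p n → m ≡ n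
  monic-unique {p = p} mp mp′ =
    proj₁ (monic-scale-unique (0≢1 ∘ ≡.sym) mp mp′ (P.sym (scale-identity p)))

  mulP-scaleʳ : ∀ c p r → mulP p (scale c r) ≈ scale c (mulP p r)
  mulP-scaleʳ c p r = P.trans (mulP-comm p (scale c r))
    (P.trans (mulP-scaleˡ c r p) (scale-cong ≡.refl (mulP-comm r p)))

  -- With `r` written as `c` times a monic `s`, the products of `p` with `r` and with `s` are both
  -- monic and differ by the factor `c`, so `c` is 1.
  monic-quotient : ∀ {m n} p r → Monic p m → Monic (mulP p r) n → ∃ λ k → n ≡ m ℕ.+ k × Monic r k
  monic-quotient {m} {n} p r mp mpr with zero⊎associated r
  ... | inj₁ r≈0 = ⊥-elim (0≢1 (≡.trans (≡.sym (at (P.trans (mulP-congˡ p r≈0) (mulP-zeroʳ p)) n)) (proj₁ mpr)))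
  ... | inj₂ (k , s , c , c≢0 , ms , r≈cs)
    with monic-scale-unique c≢0 mpr (monic-* p s mp ms) (P.trans (mulP-congˡ p r≈cs) (mulP-scaleʳ c p s))
  ...   | n≡m+k , pr≈ps with ≡.trans (≡.sym (monic-scale-lead (mulP p s) c (monic-* p s mp ms)))
                            (≡.trans (≡.sym (at (P.trans (mulP-congˡ p r≈cs) (mulP-scaleʳ c p s)) (m ℕ.+ k)))
                              (≡.trans (at pr≈ps (m ℕ.+ k)) (proj₁ (monic-* p s mp ms))))
  ...     | ≡.refl = k , n≡m+k , monic-resp (P.trans (P.sym (scale-identity s)) (P.sym r≈cs)) ms

  -- A nonzero difference of `r` and `s` is `c` times a monic, so its product with the monic `p` has
  -- leading coefficient `c`, although that product is zero.
  *-cancelˡ : ∀ {m p r s} → Monic p m → mulP p r ≈ mulP p s → r ≈ s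
  *-cancelˡ {m} {p} {r} {s} mp pr≈ps with zero⊎associated (addP r (negP s))
  ... | inj₁ r-s≈0 = p-r≈0⇒p≈r r-s≈0
  ... | inj₂ (k , t , c , c≢0 , mt , r-s≈ct) = ⊥-elim (c≢0 (≡.trans
      (≡.sym (monic-scale-lead (mulP p t) c (monic-* p t mp mt))) (at cpt≈0 (m ℕ.+ k))))
    where
    open Algebra.Properties.Ring P.ring using (x[y-z]≈xy-xz)
    cpt≈0 : scale c (mulP p t) ≈ []
    cpt≈0 = P.trans (P.sym (mulP-scaleʳ c p t)) (P.trans (P.sym (mulP-congˡ p r-s≈ct))
      (P.trans (x[y-z]≈xy-xz p r s) (P.trans (addP-cong pr≈ps (≈-refl {negP (mulP p s)}))
          (addP-inverseʳ (mulP p s)))))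

  HasDegree< : Pol → ℕ → Set
  HasDegree< p n = ∀ i → n ≤ i → coeff p i ≡ 0#

  -- Horner's scheme, as coefficients are listed from the lowest degree: the division of the tail is
  -- multiplied by the variable and `a` is added to the remainder.
  divideWithRemainder : ∀ {n p} → Monic p n → ∀ r →
    ∃₂ λ h s → r ≈ addP (mulP h p) s × HasDegree< s n
  divideWithRemainder mp []      = [] , [] , ≈-refl , λ _ _ → ≡.refl
  divideWithRemainder {n} {p} mp@(lead , p≤) (a ∷ r) with divideWithRemainder mp r
  ... | h , s , r≈hp+s , s< = c ∷ h , t , eq , t<
    where
    c : Carrier
    -- The shifted remainder `a ∷ s` may reach degree `n`; as `p` is monic, subtracting `scale c p`
    -- clears exactly that coefficient.
    c = coeff (a ∷ s) n
    t : Pol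
    t = addP (a ∷ s) (negP (scale c p))
    open Relation.Binary.Reasoning.Setoid P.setoid
    open Algebra.Properties.AbelianGroup P.+-abelianGroup using (xyx⁻¹≈y)
    eq : (a ∷ r) ≈ addP (mulP (c ∷ h) p) t
    eq = begin
      a ∷ r
        ≈⟨ ∷-cong (≡.sym (F.+-identityˡ a)) r≈hp+s ⟩
      addP (0# ∷ mulP h p) (a ∷ s)
        ≈⟨ addP-congˡ (0# ∷ mulP h p) (xyx⁻¹≈y (scale c p) (a ∷ s)) ⟨
      addP (0# ∷ mulP h p) (addP (addP (scale c p) (a ∷ s)) (negP (scale c p)))
        ≈⟨ addP-congˡ (0# ∷ mulP h p) (addP-assoc (scale c p) (a ∷ s) (negP (scale c p))) ⟩
      addP (0# ∷ mulP h p) (addP (scale c p) t)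
        ≈⟨ addP-assoc (0# ∷ mulP h p) (scale c p) t ⟨
      addP (addP (0# ∷ mulP h p) (scale c p)) t
        ≈⟨ addP-cong (addP-comm (0# ∷ mulP h p) (scale c p)) (≈-refl {t}) ⟩
      addP (addP (scale c p) (0# ∷ mulP h p)) t ∎
    coeff-t : ∀ i → coeff t i ≡ coeff (a ∷ s) i + - (c * coeff p i)
    coeff-t i = ≡.trans (coeff-addP (a ∷ s) (negP (scale c p)) i) (≡.cong (coeff (a ∷ s) i +_)
      (≡.trans (coeff-scale (- 1#) (scale c p) i) (≡.trans (-1*x≈-x _) (≡.cong -_ (coeff-scale c p i)))))
      where open Algebra.Properties.Ring F.ring using (-1*x≈-x)
    t< : HasDegree< t n
    t< i n≤i with ℕₚ.m≤n⇒m<n∨m≡n n≤i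
    ... | inj₂ ≡.refl = ≡.trans (coeff-t n) (≡.trans (≡.cong (λ x → c + - (c * x)) lead)
                          (≡.trans (≡.cong (λ x → c + - x) (F.*-identityʳ c)) (F.-‿inverseʳ c)))
    t< (suc i) n≤i | inj₁ n<i@(s≤s n≤i′) = ≡.trans (coeff-t (suc i)) (≡.trans
      (≡.cong₂ (λ x y → x + - (c * y)) (s< i n≤i′) (p≤ (suc i) n<i))
      (≡.trans (≡.cong (λ x → 0# + - x) (F.zeroʳ c)) (F.-‿inverseʳ 0#)))

  Small : ℕ → Pol → Set
  Small n r = r ≈ [] ⊎ ∃₂ λ k z → k < n × Monic z k × z ∣ r × r ∣ z

  ≈scale⇒∣ : ∀ {c p r} → c ≢ 0# → p ≈ scale c r → r ∣ p × p ∣ r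
  ≈scale⇒∣ {c} {p} {r} c≢0 p≈cr with inverse c c≢0
  ... | c⁻¹ , cc⁻¹≡1 = (scale c oneP , P.trans (unit c r) (P.sym p≈cr)) , (scale c⁻¹ oneP , r≈c⁻¹p)
    where
    unit : ∀ c r → mulP (scale c oneP) r ≈ scale c r
    unit c r = P.trans (mulP-scaleˡ c oneP r) (scale-cong ≡.refl (mulP-identityˡ r))
    r≈c⁻¹p : mulP (scale c⁻¹ oneP) p ≈ r
    r≈c⁻¹p = P.trans (unit c⁻¹ p) (P.trans (scale-cong ≡.refl p≈cr) (P.trans (P.sym (scale-assoc c⁻¹ c r))
      (P.trans (scale-cong (≡.trans (F.*-comm c⁻¹ c) cc⁻¹≡1) (≈-refl {r})) (scale-identity r))))

  small : ∀ {n} r → HasDegree< r n → Small n r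
  small {n} r r< with zero⊎associated r
  ... | inj₁ r≈0 = inj₁ r≈0
  ... | inj₂ (k , z , c , c≢0 , mz , r≈cz) = inj₂ (k , z , k<n , mz , ≈scale⇒∣ c≢0 r≈cz)
    where
    k<n : k < n
    k<n = ℕₚ.≰⇒> λ n≤k → c≢0 (≡.trans (≡.sym (monic-scale-lead z c mz))
        (≡.trans (≡.sym (at r≈cz k)) (r< k n≤k)))

  divide : ∀ {n p} → Monic p n → ∀ r → ∃₂ λ h s → r ≈ addP (mulP h p) s × Small n s
  divide mp r with divideWithRemainder mp r
  ... | h , s , e , s< = h , s , e , small s s<

  monic-diff : ∀ {m n p r s} → Monic p n → Monic r n → Monic s m → n ≤ m → s ∣ addP p (negP r) → p ≈ r
  monic-diff {m} {n} {p} {r} {s} (pn , p≤) (rn , r≤) ms n≤m s∣p-r with small (addP p (negP r)) difference<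
    where
    difference< : HasDegree< (addP p (negP r)) n
    difference< i n≤i = ≡.trans (coeff-addP p (negP r) i) (≡.trans (≡.cong₂ _+_ (same i n≤i)
      (≡.trans (coeff-scale (- 1#) r i) (-1*x≈-x _))) (F.-‿inverseʳ _))
      where
      open Algebra.Properties.Ring F.ring using (-1*x≈-x)
      same : ∀ i → n ≤ i → coeff p i ≡ coeff r i
      same i n≤i with ℕₚ.m≤n⇒m<n∨m≡n n≤i
      ... | inj₁ n<i    = ≡.trans (p≤ i n<i) (≡.sym (r≤ i n<i))
      ... | inj₂ ≡.refl = ≡.trans pn (≡.sym rn)
  ... | inj₁ p-r≈0 = p-r≈0⇒p≈r p-r≈0
  ... | inj₂ (k , z , k<n , mz , _ , p-r∣z) with ∣ʳ-trans s∣p-r p-r∣z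
  ...   | w , ws≈z with monic-quotient s w ms (monic-resp (P.trans (P.sym ws≈z) (mulP-comm w s)) mz)
  ...     | j , k≡m+j , _ = ⊥-elim (ℕₚ.<⇒≱ k<n (ℕₚ.≤-trans n≤m (≡.subst (m ≤_) (≡.sym k≡m+j) (ℕₚ.m≤m+n m j))))

  elements : List Carrier
  elements = tabulate (Inverse.from card)

  elements-complete : ∀ a → a ∈ elements
  elements-complete a = ≡.subst (_∈ elements) (Inverse.strictlyInverseʳ card a)
      (∈-tabulate⁺ (Inverse.to card a))

  elements-distinct : AllPairs _≢_ elements
  elements-distinct = Uniqueₚ.tabulate⁺ λ {i} {j} e → ≡.trans (≡.sym (Inverse.strictlyInverseˡ card i))
    (≡.trans (≡.cong (Inverse.to card) e) (Inverse.strictlyInverseˡ card j))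

  length-elements : length elements ≡ q
  length-elements = List.length-tabulate (Inverse.from card)

  -- All polynomials a₀ + ⋯ + aₙ₋₁xⁿ⁻¹ + xⁿt.
  extensions : Pol → ℕ → List Pol
  extensions t zero    = t ∷ []
  extensions t (suc n) = cartesianProductWith _∷_ elements (extensions t n)

  _extends_at_ : Pol → Pol → ℕ → Set
  p extends t at n = ∀ i → coeff p (n ℕ.+ i) ≡ coeff t i

  extensions-extend : ∀ t n → All (_extends t at n) (extensions t n)
  extensions-extend t zero    = (λ _ → ≡.refl) ∷ []
  extensions-extend t (suc n) = Allₚ.cartesianProductWith⁺ (≡.setoid Carrier)
      (≡.setoid Pol) _∷_ elements (extensions t n)
    λ _ p∈ → All.lookup (extensions-extend t n) p∈

  extensions-distinct : ∀ t n → AllPairs (λ p r → ¬ p ≈ r) (extensions t n)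
  extensions-distinct t zero    = [] ∷ []
  extensions-distinct t (suc n) = Uniqueₛ.cartesianProductWith⁺ (≡.setoid Carrier) P.setoid P.setoid _∷_
    (λ e → at e 0 , ⟨ (λ i → at e (suc i)) ⟩) elements-distinct (extensions-distinct t n)

  extensions-complete : ∀ t n p → p extends t at n → Any (p ≈_) (extensions t n)
  extensions-complete t zero    p       ext = here ⟨ ext ⟩
  extensions-complete t (suc n) []      ext = Anyₚ.cartesianProductWith⁺ _∷_
    (λ { ≡.refl e → P.trans (P.sym (∷-zero ≈-refl)) (∷-cong ≡.refl e) }) (elements-complete 0#)
        (extensions-complete t n [] ext)
  extensions-complete t (suc n) (a ∷ p) ext = Anyₚ.cartesianProductWith⁺ _∷_
    (λ { ≡.refl e → ∷-cong ≡.refl e }) (elements-complete a) (extensions-complete t n p ext)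

  length-cartesianProductWith : ∀ {A B C : Set} (f : A → B → C) xs ys →
    length (cartesianProductWith f xs ys) ≡ length xs ℕ.* length ys
  length-cartesianProductWith f []       ys = ≡.refl
  length-cartesianProductWith f (x ∷ xs) ys = ≡.trans (List.length-++ (map (f x) ys))
    (≡.cong₂ ℕ._+_ (List.length-map (f x) ys) (length-cartesianProductWith f xs ys))

  length-extensions : ∀ t n → length (extensions t n) ≡ q ^ n
  length-extensions t zero    = ≡.refl
  length-extensions t (suc n) = ≡.trans (length-cartesianProductWith _∷_ elements (extensions t n))
    (≡.cong₂ ℕ._*_ length-elements (length-extensions t n))

  extends⇒monic : ∀ {n p} → p extends oneP at n → Monic p n
  extends⇒monic {n} {p} ext = ≡.trans (≡.cong (coeff p) (≡.sym (ℕₚ.+-identityʳ n))) (ext 0) , p≤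
    where
    p≤ : HasDegree≤ p n
    p≤ i n<i with ℕₚ.m≤n⇒∃[o]m+o≡n n<i
    ... | j , ≡.refl = ≡.trans (≡.cong (coeff p) (≡.sym (ℕₚ.+-suc n j))) (ext (suc j))

  monic⇒extends : ∀ {n p} → Monic p n → p extends oneP at n
  monic⇒extends {n} {p} (lead , p≤) zero    = ≡.trans (≡.cong (coeff p) (ℕₚ.+-identityʳ n)) lead
  monic⇒extends {n} {p} (lead , p≤) (suc i) = p≤ (n ℕ.+ suc i) (ℕₚ.m<m+n n (s≤s z≤n))

  residues-complete : ∀ {n p} → Monic p n → ∀ r → Any (λ s → p ∣ addP r (negP s)) (extensions [] n)
  residues-complete {n} {p} mp r with divideWithRemainder mp r
  ... | h , s , r≈hp+s , s< = Any.map
    (λ s≈s′ → h , P.trans (P.sym (xyx⁻¹≈y s (mulP h p)))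
        (P.trans (addP-cong (addP-comm s (mulP h p)) (≈-refl {negP s}))
      (addP-cong (P.sym r≈hp+s) (scale-cong ≡.refl s≈s′))))
    (extensions-complete [] n s λ i → s< (n ℕ.+ i) (ℕₚ.m≤m+n n i))
    where open Algebra.Properties.AbelianGroup P.+-abelianGroup using (xyx⁻¹≈y)

  1<q : 1 < q
  1<q = ≡.subst (2 ≤_) length-elements (Pigeonhole.matching⇒length≤ _≡_
    (((λ _ e e′ → 0≢1 (≡.trans e (≡.sym e′))) ∷ []) ∷ [] ∷ [])
    (elements-complete 0# ∷ elements-complete 1# ∷ []))

  polynomialDomain : MonicDomain q
  polynomialDomain = record
    { commutativeRing   = polynomialRing
    ; Monic             = λ n p → Monic p n
    ; _≟_               = _≟ₚ_
    ; monic-resp        = monic-resp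
    ; monic-one         = monic-one
    ; monic-zero        = monic-zero
    ; monic-*           = λ {m} {n} {p} {r} → monic-* p r
    ; monic-unique      = λ {m} {n} {p} → monic-unique {m} {n} {p}
    ; monic-quotient    = λ {m} {n} {p} {r} → monic-quotient p r
    ; *-cancelˡ         = λ {m} {p} {r} {s} → *-cancelˡ {m} {p} {r} {s}
    ; divide            = λ {n} {p} → divide {n} {p}
    ; monic-diff        = λ {m} {n} {p} {r} {s} → monic-diff {m} {n} {p} {r} {s}
    -- Ending in `oneP` the extensions are the monics of degree n; ending in `[]` they are the
    -- polynomials of degree below n, which represent the residues.
    ; monics            = extensions oneP
    ; monics-monic      = λ n → All.map (λ {p} → extends⇒monic {n} {p}) (extensions-extend oneP n)
    ; monics-distinct   = extensions-distinct oneP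
    ; monics-complete   = λ {n} {p} mp → extensions-complete oneP n p (monic⇒extends {n} {p} mp)
    ; length-monics     = length-extensions oneP
    ; residues          = extensions []
    ; length-residues   = length-extensions []
    ; residues-complete = residues-complete
    ; zero-residue      = λ n → extensions-complete [] n [] (λ _ → ≡.refl)
    ; 1<q               = 1<q
    }

-- Identification of the extremal families

module Classification {q : ℕ} (K : FiniteField q) where
  open FiniteField K
  open Poly K
  open PolynomialRing K
  open PolynomialDomain K
  open Divisibility polynomialRing
  open Irreducibles polynomialDomain
  open ExtremalFamilies polynomialDomain
  open ExistenceOfIrreducibles polynomialDomain using (irreducible-exists)
  open Pigeonhole
  open ProductsOfTwoLinear polynomialDomain using (module TwoLinear)
  private
    module F = CommutativeRing fieldRing
    module P = CommutativeRing polynomialRing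

  ≈ₚ⇒≈ : ∀ p r → p ≈ₚ r → p ≈ r
  ≈ₚ⇒≈ _ _ e = ⟨ e ⟩

  ∣ₚ⇒∣ : ∀ {p r} → p ∣ₚ r → p ∣ r
  ∣ₚ⇒∣ {p} (h , e) = h , P.trans (mulP-comm h p) ⟨ e ⟩

  ∣⇒∣ₚ : ∀ {p r} → p ∣ r → p ∣ₚ r
  ∣⇒∣ₚ {p} (h , e) = h , at (P.trans (mulP-comm p h) e)

  ∈⇒∈ₚ : ∀ {p F} → p ∈ F → p ∈ₚ F
  ∈⇒∈ₚ = Any.map λ { ≡.refl i → ≡.refl }

  monic⇒hasDegree : ∀ {n} p → Monic p n → HasDegree p n
  monic⇒hasDegree p (lead , p≤) = (λ p≡0 → 0≢1 (≡.trans (≡.sym p≡0) lead)) , p≤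

  -- `IsLcmOfDeg` ranges over all polynomials of degree `d`, the complements only over monic ones;
  -- normalizing the leading coefficient bridges the two.
  hasDegree⇒associated : ∀ {n} p → HasDegree p n → ∃ λ r → Monic r n × p ∣ r
  hasDegree⇒associated {n} p (p≢0 , p≤) with zero⊎associated p
  ... | inj₁ p≈0 = ⊥-elim (p≢0 (at p≈0 n))
  ... | inj₂ (k , r , c , c≢0 , mr@(_ , r≤) , p≈cr) with ℕₚ.<-cmp k n
  ...   | tri< k<n _ _ = ⊥-elim (p≢0 (≡.trans (at p≈cr n) (≡.trans (coeff-scale c r n)
                           (≡.trans (≡.cong (c *_) (r≤ n k<n)) (F.zeroʳ c)))))
  ...   | tri≈ _ ≡.refl _ = r , mr , proj₂ (≈scale⇒∣ c≢0 p≈cr)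
  ...   | tri> _ _ n<k = ⊥-elim
      (c≢0 (≡.trans (≡.sym (monic-scale-lead r c mr)) (≡.trans (≡.sym (at p≈cr k)) (p≤ k n<k))))

  -- The distinct elements 0 and 1 fill a list of length 2.
  F₂-elements : q ≡ 2 → ∀ a → a ≡ 0# ⊎ a ≡ 1#
  F₂-elements q≡2 a with matching-surjective _≡_ {xs = 0# ∷ 1# ∷ []}
      (((λ _ e e′ → 0≢1 (≡.trans e (≡.sym e′))) ∷ []) ∷ [] ∷ [])
      (elements-complete 0# ∷ elements-complete 1# ∷ [])
      (ℕₚ.≤-reflexive (≡.trans length-elements q≡2)) (elements-complete a)
      (λ b → map′ (λ a≡b → a , ≡.refl , ≡.sym a≡b) (λ { (_ , ≡.refl , ≡.refl) → ≡.refl }) (a ≟ꟳ b))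
  ... | here (_ , ≡.refl , ≡.refl)         = inj₁ ≡.refl
  ... | there (here (_ , ≡.refl , ≡.refl)) = inj₂ ≡.refl

  mulP-X : ∀ p → mulP X p ≈ (0# ∷ p)
  mulP-X p = P.trans (mulP-shiftˡ oneP p) (∷-cong ≡.refl (mulP-identityˡ p))

  mulP-X+1 : ∀ p → mulP X+1 p ≈ addP p (0# ∷ p)
  mulP-X+1 p = addP-cong (scale-identity p) (∷-cong ≡.refl (mulP-identityˡ p))

  X-monic : Monic X 1
  X-monic = ≡.refl , λ { (suc (suc i)) _ → ≡.refl ; (suc zero) (s≤s ()) }

  X+1-monic : Monic X+1 1
  X+1-monic = ≡.refl , λ { (suc (suc i)) _ → ≡.refl ; (suc zero) (s≤s ()) }

  X-X+1-coprime : Coprime X X+1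
  X-X+1-coprime = negP oneP , oneP , P.trans (addP-cong (-1*x≈-x X) (mulP-identityˡ X+1))
    (P.trans (addP-congˡ (negP X) X+1≈X+1) (\\-leftDividesʳ X oneP))
    where
    open Algebra.Properties.Ring P.ring using (-1*x≈-x)
    open Algebra.Properties.Group P.+-group using (\\-leftDividesʳ)
    X+1≈X+1 : X+1 ≈ addP X oneP
    X+1≈X+1 = ∷-cong (≡.sym (F.+-identityˡ 1#)) ≈-refl

  module _ (q≡2 : q ≡ 2) where

    1+1≡0 : 1# + 1# ≡ 0#
    1+1≡0 with F₂-elements q≡2 (1# + 1#)
    ... | inj₁ e = e
    ... | inj₂ e = ⊥-elim (0≢1 (≡.sym (+-cancelˡ 1# 1# 0# (≡.trans e (≡.sym (F.+-identityʳ 1#))))))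
      where open Algebra.Properties.Group F.+-group using () renaming (∙-cancelˡ to +-cancelˡ)

    linear : ∀ p → Monic p 1 → p ≈ X ⊎ p ≈ X+1
    linear p (lead , p≤) = Sum.map (λ e → P.trans p≈ (∷-cong e ≈-refl)) (λ e → P.trans p≈ (∷-cong e ≈-refl))
      (F₂-elements q≡2 (coeff p 0))
      where
      p≈ : p ≈ (coeff p 0 ∷ 1# ∷ [])
      p≈ = ⟨ (λ { zero → ≡.refl ; (suc zero) → lead ; (suc (suc i)) → p≤ (suc (suc i)) (s≤s (s≤s z≤n)) }) ⟩

    -- Of the four monic quadratics, the two with constant term 0 are divisible by `X`, and x² + 1
    -- is the square of `X+1` in characteristic 2.
    irreducible-quadratic : ∀ p → Irreducible 2 p → p ≈ X²+X+1
    irreducible-quadratic p ((lead , p≤) , _ , prime) = cases (F₂-elements q≡2 (coeff p 0))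
        (F₂-elements q≡2 (coeff p 1))
      where
      p≈ : p ≈ (coeff p 0 ∷ coeff p 1 ∷ 1# ∷ [])
      p≈ = ⟨ (λ { zero → ≡.refl ; (suc zero) → ≡.refl ; (suc (suc zero)) → lead
                ; (suc (suc (suc i))) → p≤ (suc (suc (suc i))) (s≤s (s≤s (s≤s z≤n))) }) ⟩
      no-linear-divisor : ∀ {r h} → Monic r 1 → ¬ mulP r h ≈ p
      no-linear-divisor {r} {h} mr e =
          prime (monic-properDivisor (s≤s (s≤s z≤n)) (s≤s z≤n) mr (h , P.trans (mulP-comm h r) e))
      cases : coeff p 0 ≡ 0# ⊎ coeff p 0 ≡ 1# → coeff p 1 ≡ 0# ⊎ coeff p 1 ≡ 1# → p ≈ X²+X+1
      cases (inj₁ c₀) _ = ⊥-elim (no-linear-divisor {X} {coeff p 1 ∷ 1# ∷ []} X-monic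
        (P.trans (mulP-X _) (P.sym (P.trans p≈ (∷-cong c₀ ≈-refl)))))
      cases (inj₂ c₀) (inj₁ c₁) = ⊥-elim (no-linear-divisor {X+1} {X+1} X+1-monic
        (P.trans (mulP-X+1 X+1) (P.sym (P.trans p≈ (∷-cong (≡.trans c₀ (≡.sym (F.+-identityʳ 1#)))
          (∷-cong (≡.trans c₁ (≡.sym 1+1≡0)) ≈-refl))))))
      cases (inj₂ c₀) (inj₂ c₁) = P.trans p≈ (∷-cong c₀ (∷-cong c₁ ≈-refl))

  -- Serves to exclude `d = 0`: a single member of degree `ℓ` is its own only monic multiple of that
  -- degree, which makes the family trivial.
  singleton-multiples : ∀ {n F} → All (λ f → Monic f n) F → length F ≡ 1 →
    ∃ λ g → Monic g n × All (g ∣_) F × (∀ {f} → Monic f n → g ∣ f → Any (f ≈_) F)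
  singleton-multiples {F = g ∷ []} (mg ∷ []) _ =
    g , mg , ∣ʳ-refl ∷ [] , λ mf g∣f → here (P.sym (monic-∣⇒≈ mg mf ℕₚ.≤-refl g∣f))

  module _ {ℓ d : ℕ} {F : List Pol} (family : IsFamily (ℓ ℕ.+ d) F) (intersecting : LIntersecting ℓ F)
    (size : length F ≡ q ^ d) (primary : Primary F) (nontrivial : ¬ Trivial (ℓ ℕ.+ d) ℓ F) where

    private
      F-monic : All (λ f → Monic f (ℓ ℕ.+ d)) F
      F-monic = proj₁ family

      F-distinct : AllPairs (λ f g → ¬ f ≈ g) F
      F-distinct = AllPairs.map (λ f≉g f≈g → f≉g (at f≈g)) (proj₂ family)

      F-primary : ∀ {c} → All (c ∣_) F → c ∣ oneP
      F-primary {c} c∣F = ∣ₚ⇒∣ {c} {oneP} (primary c λ f f∈ → let g , g∈ , f≈g = find f∈ in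
        ∣⇒∣ₚ {c} {f} (∣ʳ-respʳ-≈ (P.sym (≈ₚ⇒≈ f g f≈g)) (All.lookup c∣F g∈)))

      F-intersecting : ∀ {f g} → f ∈ F → g ∈ F → ∃₂ λ m c → Monic c m × ℓ ≤ m × c ∣ f × c ∣ g
      F-intersecting {f} {g} f∈ g∈ with intersecting f g (∈⇒∈ₚ f∈) (∈⇒∈ₚ g∈)
      ... | c , m , (c∣f , c∣g , _) , mc , ℓ≤m = m , c , mc , ℓ≤m , ∣ₚ⇒∣ {c} {f} c∣f , ∣ₚ⇒∣ {c} {g} c∣g

    not-all-multiples : ∀ g → Monic g ℓ → All (g ∣_) F →
      ¬ (∀ {f} → Monic f (ℓ ℕ.+ d) → g ∣ f → Any (f ≈_) F)
    not-all-multiples g mg g∣F present = nontrivial (g , mg , λ f → mk⇔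
      (λ f∈ → let h , h∈ , f≈h = find f∈ ; h≈f = P.sym (≈ₚ⇒≈ f h f≈h) in
        monic-resp h≈f (All.lookup F-monic h∈) , ∣⇒∣ₚ {g} {f} (∣ʳ-respʳ-≈ h≈f (All.lookup g∣F h∈)))
      (λ (mf , g∣f) → Any.map at (present {f} mf (∣ₚ⇒∣ {g} {f} g∣f))))

    d>0 : 0 < d
    d>0 = ℕₚ.n≢0⇒n>0 λ { ≡.refl → let g , mg , g∣F , present = singleton-multiples F-monic size in
      not-all-multiples g (≡.subst (Monic g) (ℕₚ.+-identityʳ ℓ) mg) g∣F (λ {f} → present {f}) }

    -- `H′` is a common multiple of all polynomials of degree `d`, so `H` divides it. The quotient
    -- `k` divides every member, hence is 1 by primarity, and `H` equals `H′`.
    complementary-InFd : ∀ H′ → All (λ f → ∃ λ p → Monic p d × mulP f p ≈ H′) F →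
      (∀ {p} → Monic p d → Any (λ f → mulP f p ≈ H′) F) →
      ∀ H → IsLcmOfDeg d H → F equalsSet InFd d H
    complementary-InFd H′ complements present H ((m , mH) , multiple , least) f = mk⇔
      (λ f∈ → let g , g∈ , f≈g = find f∈
                  p , mp , gp≈H′ = All.lookup complements g∈
              in p , mp , at (P.trans (mulP-comm p f) (P.trans (mulP-congʳ p (≈ₚ⇒≈ f g f≈g))
                   (P.trans gp≈H′ (P.sym H≈H′)))))
      (λ (p , mp , pf≈H) → Any.map (λ {g} gp≈H′ → at (*-cancelˡ {p = p} {f} {g} mp
          (P.trans (≈ₚ⇒≈ (mulP p f) H pf≈H) (P.trans H≈H′ (P.trans (P.sym gp≈H′) (mulP-comm g p))))))
        (present {p} mp))
      where
      H∣H′ : H ∣ H′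
      H∣H′ = ∣ₚ⇒∣ {H} {H′} (least H′ λ p deg →
        let r , mr , p∣r = hasDegree⇒associated p deg
            g , _ , gr≈H′ = find (present {r} mr)
        in ∣⇒∣ₚ {p} {H′} (∣ʳ-trans p∣r (g , gr≈H′)))
      quotient = monicQuotient H∣H′
        where
        some-complement : ∃ λ f → ∃ λ p → f ∈ F × Monic p d × mulP f p ≈ H′
        some-complement =
          let π , mπ , _ = irreducible-exists d>0
              g , g∈ , e = find (present {π} mπ)
          in g , π , g∈ , mπ , e
        -- A member and its complement exhibit `H′` as a product of two monics; the irreducible of
        -- degree `d` supplies such a pair.
        mH′ : Monic H′ (ℓ ℕ.+ d ℕ.+ d)
        mH′ = let g , p , g∈ , mp , e = some-complement in monic-resp e (monic-* g p (All.lookup F-monic g∈) mp)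
        monicQuotient : H ∣ H′ → ∃₂ λ j k → Monic k j × mulP H k ≈ H′
        monicQuotient d = let j , k , _ , mk , e = monic-quotientʳ mH mH′ d in j , k , mk , e
      j = proj₁ quotient
      k = proj₁ (proj₂ quotient)
      mk : Monic k j
      mk = proj₁ (proj₂ (proj₂ quotient))
      Hk≈H′ : mulP H k ≈ H′
      Hk≈H′ = proj₂ (proj₂ (proj₂ quotient))
      -- With H = p·h, cancelling `p` from g·p = H′ = p·h·k leaves g = h·k.
      k∣F : All (k ∣_) F
      k∣F = All.map (λ {g} (p , mp , gp≈H′) → let h , hp≈H = ∣ₚ⇒∣ {p} {H} (multiple p (monic⇒hasDegree p mp)) in
        h , *-cancelˡ {p = p} {mulP h k} {g} mp
            (P.trans (P.sym (mulP-assoc p h k)) (P.trans (mulP-congʳ k (P.trans (mulP-comm p h) hp≈H))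
              (P.trans Hk≈H′ (P.trans (P.sym gp≈H′) (mulP-comm g p)))))) complements
      H≈H′ : H ≈ H′
      H≈H′ = P.trans (P.sym (P.*-identityʳ H)) (P.trans (mulP-congˡ H (P.sym k≈1)) Hk≈H′)
        where
        k≈1 : k ≈ oneP
        k≈1 = monic-∣⇒≈ {x = k} mk monic-one z≤n (F-primary k∣F)

    exceptional-family : ∀ {π x} → q ≡ 2 → d ≡ 2 → Irreducible 2 π → Monic x (suc ℓ) →
      All (λ f → ∃ λ y → Monic y 1 × (mulP f y ≈ mulP π x ⊎ mulP x y ≈ f)) F →
      (∀ {y} → Monic y 1 → y ∣ x) → ℓ ≡ 1 × F equalsSet InExceptional
    exceptional-family {π} {x} q≡2 d≡2 irr mx members linear∣x = proj₁ twoLinear , λ f → mk⇔ (to f) (from f)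
      where
      E : Pol → List Pol
      E π = mulP (mulP X X) X+1 ∷ mulP X (mulP X+1 X+1) ∷ mulP X π ∷ mulP X+1 π ∷ []
      twoLinear : ℓ ≡ 1 × All (λ f → Any (f ≈_) (E π)) F
      twoLinear = TwoLinear.members-listed {a = X} {X+1} {π} {x} X-monic X+1-monic X-X+1-coprime
          (λ {y} → linear q≡2 y) mx
        (λ {y} → linear∣x {y}) members F-primary
      listed : ∀ {f} → Any (f ≈_) (E π) → Any (f ≈_) (E X²+X+1)
      listed (here e)                         = here e
      listed (there (here e))                 = there (here e)
      listed (there (there (here e)))         = there (there (here (P.trans e (mulP-congˡ X π≈))))
        where π≈ = irreducible-quadratic q≡2 π irr
      listed (there (there (there (here e)))) = there (there (there (here (P.trans e (mulP-congˡ X+1 π≈)))))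
        where π≈ = irreducible-quadratic q≡2 π irr
      to : ∀ f → f ∈ₚ F → InExceptional f
      to f f∈ with find f∈
      ... | g , g∈ , f≈g with listed (All.lookup (proj₂ twoLinear) g∈)
      ...   | here e                         = inj₁ (at (P.trans (≈ₚ⇒≈ f g f≈g) e))
      ...   | there (here e)                 = inj₂ (inj₁ (at (P.trans (≈ₚ⇒≈ f g f≈g) e)))
      ...   | there (there (here e))         = inj₂ (inj₂ (inj₁ (at (P.trans (≈ₚ⇒≈ f g f≈g) e))))
      ...   | there (there (there (here e))) = inj₂ (inj₂ (inj₂ (at (P.trans (≈ₚ⇒≈ f g f≈g) e))))
      -- The family has `2 ^ 2` distinct members, all in a list of length four, so every entry of
      -- that list occurs.
      present : ∀ {f} → Any (f ≈_) (E X²+X+1) → f ∈ₚ F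
      present {f} i = Any.map (λ (r , f≈r , g≈r) → at (P.trans f≈r (P.sym g≈r)))
        (matching-surjective _≈_ (AllPairs.map (λ f≉g r e e′ → f≉g (P.trans e (P.sym e′))) F-distinct)
          (All.map listed (proj₂ twoLinear))
          (ℕₚ.≤-reflexive (≡.sym (≡.trans size (≡.cong₂ _^_ q≡2 d≡2)))) i
          (λ g → map′ (λ (f≈g : f ≈ g) → f , ≈-refl , P.sym f≈g)
              (λ (r , f≈r , g≈r) → P.trans f≈r (P.sym g≈r)) (f ≟ₚ g)))
      from : ∀ f → InExceptional f → f ∈ₚ F
      from f (inj₁ e)               = present {f} (here ⟨ e ⟩)
      from f (inj₂ (inj₁ e))        = present {f} (there (here ⟨ e ⟩))
      from f (inj₂ (inj₂ (inj₁ e))) = present {f} (there (there (here ⟨ e ⟩)))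
      from f (inj₂ (inj₂ (inj₂ e))) = present {f} (there (there (there (here ⟨ e ⟩))))

    classification : (q ≡ 2 × ℓ ≡ 1 × ℓ ℕ.+ d ≡ 3 × F equalsSet InExceptional)
      ⊎ (0 < d × (∀ H → IsLcmOfDeg d H → F equalsSet InFd d H))
    classification = conclude (structure d>0 F-monic F-distinct size F-intersecting F-primary)
      where
      conclude : Structure d>0 F-monic F-distinct size F-intersecting F-primary → _
      conclude (trivial g mg g∣F present) = ⊥-elim (not-all-multiples g mg g∣F present)
      conclude (complementary H complements present) = inj₂ (d>0 , complementary-InFd H complements present)
      conclude (exceptional q≡2 d≡2 irr mx members linear∣x) =
        let ℓ≡1 , equal = exceptional-family q≡2 d≡2 irr mx members linear∣x
        in inj₁ (q≡2 , ℓ≡1 , ≡.cong₂ ℕ._+_ ℓ≡1 d≡2 , equal)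

theorem4 : (q : ℕ) → IsPrimePower q → (K : FiniteField q) →
    (n ℓ : ℕ) → ℓ ≤ n → (F : List (Poly.Pol K)) →
    Poly.IsFamily K n F →
    Poly.LIntersecting K ℓ F →
    length F ≡ q ^ (n ∸ ℓ) →
    Poly.Primary K F →
    ¬ Poly.Trivial K n ℓ F →
    (q ≡ 2 × ℓ ≡ 1 × n ≡ 3 × Poly._equalsSet_ K F (Poly.InExceptional K))
    ⊎ (0 < n ∸ ℓ × (∀ H → Poly.IsLcmOfDeg K (n ∸ ℓ) H →
    Poly._equalsSet_ K F (Poly.InFd K (n ∸ ℓ) H)))
-- Replaces `n` by `ℓ + d`. The later hypotheses are still in the goal type here, so the abstraction
-- rewrites them as well.
theorem4 q _ K n ℓ ℓ≤n F with n ∸ ℓ | ℕₚ.m+[n∸m]≡n ℓ≤n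
... | d | ≡.refl = Classification.classification K
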